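{- Let $q=2^t$ with $t$ even, and let $n\geq 4$ be even. Then there exists a complete cap in the affine space $AG(n,q)$ of size $2\sqrt{q}^{\,n-1}$.
   Context: A cap in an affine or projective space over a finite field is a set of points no three of which are collinear. A cap is complete if it is maximal with respect to set-theoretic inclusion among caps. -}

module Defs where

open import Level using (0ℓ)
open import Data.Nat using (ℕ; _*_)
open import Data.Fin using (Fin)
open import Data.Product using (Σ; ∃; _×_)
open import Data.List using (List)
open import Data.List.Membership.Propositional using (_∈_)
open import Data.List.Relation.Unary.Unique.Propositional using (Unique)
open import Algebra.Core using (Op₂; Op₁)
open import Algebra.Structures using (IsCommutativeRing)
open import Relation.Binary.PropositionalEquality using (_≡_; _≢_)
open import Relation.Nullary using (¬_)

record FiniteField (q : ℕ) : Set where
  field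
    _+_ _·_ : Op₂ (Fin q)
    -_      : Op₁ (Fin q)
    0# 1#   : Fin q
    isCommutativeRing : IsCommutativeRing _≡_ _+_ _·_ -_ 0# 1#
    0≢1     : 0# ≢ 1#
    _⁻¹     : Fin q → Fin q
    ⁻¹-inverse : ∀ x → x ≢ 0# → x · (x ⁻¹) ≡ 1#

module AffineSpace {q : ℕ} (F : FiniteField q) (n : ℕ) where
  open FiniteField F

  Point : Set
  Point = Fin n → Fin q

  -- three points a, b, c are collinear: c lies on the line through a and b,
  -- i.e. c = a + λ (b - a) for some scalar λ (applied when a ≠ b)
  Collinear : Point → Point → Point → Set
  Collinear a b c = Σ (Fin q) λ l → ∀ i → c i ≡ a i + (l · (b i + (- (a i))))

  IsCap : List Point → Set
  IsCap C = Unique C × (∀ {a b c} → a ∈ C → b ∈ C → c ∈ C →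
            a ≢ b → a ≢ c → b ≢ c → ¬ Collinear a b c)

  IsComplete : List Point → Set
  IsComplete C = IsCap C × (∀ D → IsCap D → (∀ {x} → x ∈ C → x ∈ D) →
                                  (∀ {x} → x ∈ D → x ∈ C))

{-# OPTIONS --safe #-}

-- Put s = √q = 2^k and let F₀ be the subfield of order s. Suppose that a set G of s^r points of
-- AG(r, q) is such that for every l ≠ 0, 1 the map (g, h) ↦ g + l (h - g) on G × G is injective.
-- Since |G|² = q^r it is then bijective, and G × {0, 1} is a complete cap of AG(r + 1, q): a point
-- at height l ≠ 0, 1 lies on a secant joining the two levels, a point at height 0 or 1 on a secant
-- within its level. Such sets are closed under products, and {(y, y²)} is one for r = 2, so
-- everything reduces to r = 3.
--
-- For r = 3 take G = {x + ω S x : x ∈ F₀³}, where ω has trace 1 over F₀ and S is injective, additive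
-- and semilinear for a power map of F₀ fixing only 0 and 1. Writing λ = a + ω b with a, b ∈ F₀, the
-- map is injective as soon as no x ≠ 0 satisfies S² x = c₁ S x + c₀ x with c₀ ≠ 0. If 3 | k, then
-- S (x, y, z) = (c z², x², y²) works when c is not a seventh power. Otherwise α³ + α + 1 is irreducible
-- over F, and S x = m x⁸ on F₀[α] works when m is not a seventh power in F[α].

module Submission where

open import Defs
open import Algebra.Bundles using (CommutativeRing)
open import Algebra.Core using (Op₁; Op₂)
import Algebra.Properties.CommutativeMonoid.Sum
import Algebra.Properties.CommutativeSemiring.Exp
import Algebra.Properties.Group
import Algebra.Properties.Ring
import Algebra.Solver.Ring
open import Algebra.Solver.Ring.AlmostCommutativeRing using (fromCommutativeRing; _-Raw-AlmostCommutative⟶_)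
open import Algebra.Structures using (IsCommutativeRing)
open import Data.Bool using (Bool; true; false)
open import Data.Bool.Properties using (xor-∧-commutativeRing)
open import Data.Empty using (⊥; ⊥-elim)
open import Data.Fin using (Fin; zero; suc; punchIn; punchOut; inject≤; combine; remQuot; funToFin; finToFun)
open import Data.Fin.Patterns using (0F; 1F; 2F)
open import Data.Fin.Permutation using (Permutation′; permutation)
open import Data.Fin.Properties using
  ( any?; ¬∀⟶∃¬; ¬Fin0; suc-injective; injective⇒≤; inject≤-injective
  ; punchIn-injective; punchInᵢ≢i; punchOut-injective; punchIn-punchOut
  ; combine-injective; combine-remQuot; remQuot-combine; finToFun-funToFin
  ) renaming (_≟_ to _≟ᶠ_)
open import Data.List using (List; tabulate; length)
open import Data.List.Membership.Propositional using (_∈_)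
open import Data.List.Membership.Propositional.Properties using (∈-tabulate⁺; ∈-tabulate⁻)
open import Data.List.Properties using (length-tabulate)
import Data.List.Relation.Unary.All as All
open import Data.List.Relation.Unary.AllPairs using (_∷_)
open import Data.List.Relation.Unary.Any using (here; there)
open import Data.List.Relation.Unary.Unique.Propositional using (Unique)
open import Data.List.Relation.Unary.Unique.Propositional.Properties using (tabulate⁺)
open import Data.Maybe using (Maybe; just; nothing)
open import Data.Nat using (ℕ; zero; suc; _≤_; _<_; z≤n; s≤s)
import Data.Nat as ℕ
open import Data.Nat.Divisibility using (_∣_; divides)
open import Data.Nat.DivMod using (m*n/n≡m)
import Data.Nat.Properties as ℕₚ
open import Data.Nat.Tactic.RingSolver using (solve-∀)
open import Data.Product using (Σ; ∃; ∃₂; _,_; proj₁; proj₂; _×_; uncurry)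
open import Data.Product.Properties using (≡-dec)
open import Data.Sum using (_⊎_; inj₁; inj₂; [_,_])
open import Data.Vec using (Vec; []; _∷_; replicate)
open import Function using (_∘_)
open import Level using (0ℓ)
open import Relation.Binary.PropositionalEquality hiding ([_])
open import Relation.Nullary using (¬_; Dec; yes; no; contradiction)
open import Relation.Unary using (Decidable)

-- Additivity of G turns injectivity into a statement about single vectors: two equal points on
-- secants give ((l + 1)/l)(g + g') = h + h', and (l + 1)/l is neither 0 nor 1, so it suffices that
-- no scalar other than 0 and 1 carries a nonzero element of G into G. In particular G must not be
-- closed under any subfield larger than F₂, which is why S is semilinear for a power map moving
-- every scalar of F₀ except 0 and 1. Seventh powers come from x ↦ m x^σ. Dividing S² x = c₁ S x +
-- c₀ x by x and putting Y = m x^(σ-1) gives Y^(σ+1) = c₁ Y + c₀, so m counts only modulo (σ-1)-th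
-- powers. Wanted is a prime dividing σ - 1 and q³ - 1 but not q - 1: for σ = 8 this is 7, which
-- always divides q³ - 1, and divides q - 1 exactly when 3 | k. In that case the eighth power would
-- fix F₈ inside F₀, so σ = 2 is taken instead; the exponent 8 returns in S³ (x, y, z) = (c x⁸, c²
-- y⁸, c⁴ z⁸).

injective⇒surjective : ∀ {m n} → n ≤ m → (f : Fin m → Fin n) → (∀ {i j} → f i ≡ f j → i ≡ j) →
                       ∀ y → ∃ λ x → f x ≡ y
injective⇒surjective {m} {suc n} n<m f f-inj y with any? (λ x → f x ≟ᶠ y)
... | yes hit = hit
... | no miss = contradiction n<m (ℕₚ.≤⇒≯ (injective⇒≤ g-inj))
  where
  g : Fin m → Fin n
  g x = punchOut {i = y} {j = f x} (λ y≡fx → miss (x , sym y≡fx))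
  g-inj : ∀ {i j} → g i ≡ g j → i ≡ j
  g-inj = f-inj ∘ punchOut-injective {i = y} _ _

-- Powers, characteristic 2 and units in commutative rings.

module RingOps {A : Set} {_+_ _·_ : Op₂ A} { -_ : Op₁ A} {0# 1# : A}
               (isCR : IsCommutativeRing _≡_ _+_ _·_ -_ 0# 1#) where

  commutativeRing : CommutativeRing 0ℓ 0ℓ
  commutativeRing = record { isCommutativeRing = isCR }

  open CommutativeRing commutativeRing public
    using (+-assoc; +-comm; +-identityˡ; +-identityʳ; *-assoc; *-comm; *-identityˡ; *-identityʳ; zeroˡ; zeroʳ)
  open Algebra.Properties.CommutativeSemiring.Exp (CommutativeRing.commutativeSemiring commutativeRing) public
    using (_^_; ^-homo-*; ^-assocʳ; ^-distrib-*)

  1^ : ∀ n → 1# ^ n ≡ 1#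
  1^ zero    = refl
  1^ (suc n) = trans (*-identityˡ _) (1^ n)

  ^-comm : ∀ x m n → (x ^ m) ^ n ≡ (x ^ n) ^ m
  ^-comm x m n = trans (^-assocʳ x m n) (trans (cong (x ^_) (ℕₚ.*-comm m n)) (sym (^-assocʳ x n m)))

module Char2 {A : Set} {_+_ _·_ : Op₂ A} { -_ : Op₁ A} {0# 1# : A}
             (isCR : IsCommutativeRing _≡_ _+_ _·_ -_ 0# 1#) (1+1≡0 : (1# + 1#) ≡ 0#) where

  open RingOps isCR public

  private
    ⟦_⟧ᵇ : Bool → A
    ⟦ false ⟧ᵇ = 0#
    ⟦ true  ⟧ᵇ = 1#

    -1≡1 : (- 1#) ≡ 1#
    -1≡1 = sym (Algebra.Properties.Group.inverseˡ-unique (CommutativeRing.+-group commutativeRing) 1# 1# 1+1≡0)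

    𝔽₂⟶ : CommutativeRing.rawRing xor-∧-commutativeRing -Raw-AlmostCommutative⟶ fromCommutativeRing commutativeRing
    𝔽₂⟶ = record
      { ⟦_⟧    = ⟦_⟧ᵇ
      ; +-homo = λ { false _ → sym (+-identityˡ _) ; true false → sym (+-identityʳ _) ; true true → sym 1+1≡0 }
      ; *-homo = λ { false _ → sym (zeroˡ _) ; true _ → sym (*-identityˡ _) }
      ; -‿homo = λ { false → sym (Algebra.Properties.Ring.-0#≈0# (CommutativeRing.ring commutativeRing)) ; true → sym -1≡1 }
      ; 0-homo = refl
      ; 1-homo = refl
      }

    _≟ᵇ_ : ∀ a b → Maybe (⟦ a ⟧ᵇ ≡ ⟦ b ⟧ᵇ)
    false ≟ᵇ false = just refl
    true  ≟ᵇ true  = just refl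
    _     ≟ᵇ _     = nothing

  -- Coefficients in 𝔽₂, so that the solver knows that 2 = 0.
  open Algebra.Solver.Ring (CommutativeRing.rawRing xor-∧-commutativeRing)
    (fromCommutativeRing commutativeRing) 𝔽₂⟶
    _≟ᵇ_ public
    using (solve; _:+_; _:*_; _:^_; _:=_; con; :-_)

  x+x≡0 : ∀ x → (x + x) ≡ 0#
  x+x≡0 = solve 1 (λ x → x :+ x := con false) refl

  x+y≡0⇒x≡y : ∀ {x y} → (x + y) ≡ 0# → x ≡ y
  x+y≡0⇒x≡y {x} {y} e = trans (solve 2 (λ x y → x := (x :+ y) :+ y) refl x y) (trans (cong (_+ y) e) (+-identityˡ y))

  +-cancelʳ : ∀ {x y z} → (x + z) ≡ (y + z) → x ≡ y
  +-cancelʳ {x} {y} {z} e = trans (add x) (trans (cong (_+ z) e) (sym (add y)))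
    where add : ∀ x → x ≡ ((x + z) + z)
          add x = solve 2 (λ x z → x := (x :+ z) :+ z) refl x z

  frobenius : ∀ x y → (x + y) ^ 2 ≡ ((x ^ 2) + (y ^ 2))
  frobenius = solve 2 (λ x y → (x :+ y) :^ 2 := x :^ 2 :+ y :^ 2) refl

  frobenius^ : ∀ j x y → (x + y) ^ (2 ℕ.^ j) ≡ ((x ^ (2 ℕ.^ j)) + (y ^ (2 ℕ.^ j)))
  frobenius^ zero    x y = solve 2 (λ x y → (x :+ y) :^ 1 := x :^ 1 :+ y :^ 1) refl x y
  frobenius^ (suc j) x y = begin
    (x + y) ^ (2 ℕ.* 2 ℕ.^ j)                                  ≡⟨ ^-assocʳ (x + y) 2 (2 ℕ.^ j) ⟨
    ((x + y) ^ 2) ^ (2 ℕ.^ j)                                  ≡⟨ cong (_^ (2 ℕ.^ j)) (frobenius x y) ⟩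
    ((x ^ 2) + (y ^ 2)) ^ (2 ℕ.^ j)                            ≡⟨ frobenius^ j (x ^ 2) (y ^ 2) ⟩
    (((x ^ 2) ^ (2 ℕ.^ j)) + ((y ^ 2) ^ (2 ℕ.^ j)))            ≡⟨ cong₂ _+_ (^-assocʳ x 2 (2 ℕ.^ j)) (^-assocʳ y 2 (2 ℕ.^ j)) ⟩
    ((x ^ (2 ℕ.* 2 ℕ.^ j)) + (y ^ (2 ℕ.* 2 ℕ.^ j)))            ∎
    where open ≡-Reasoning

-- Phrased for a ring on any type whose nonzero elements are invertible, so that it serves both F
-- and the cubic extension carried by triples.
module Units {A : Set} {_+_ _·_ : Op₂ A} { -_ : Op₁ A} {0# 1# : A}
             (isCR : IsCommutativeRing _≡_ _+_ _·_ -_ 0# 1#) (0≢1 : 0# ≢ 1#)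
             (unit : ∀ x → x ≢ 0# → ∃ λ y → (x · y) ≡ 1#) where

  open RingOps isCR

  ·-cancelʳ : ∀ {x y z} → z ≢ 0# → (x · z) ≡ (y · z) → x ≡ y
  ·-cancelʳ {x} {y} {z} z≢0 e with w , zw≡1 ← unit z z≢0 =
    trans (strip x) (trans (cong (_· w) e) (sym (strip y)))
    where
    strip : ∀ x → x ≡ ((x · z) · w)
    strip x = sym (trans (*-assoc x z w) (trans (cong (x ·_) zw≡1) (*-identityʳ x)))

  ·-nonzero : ∀ {x y} → x ≢ 0# → y ≢ 0# → (x · y) ≢ 0#
  ·-nonzero {x} {y} x≢0 y≢0 e = x≢0 (·-cancelʳ y≢0 (trans e (sym (zeroˡ y))))

  ^-nonzero : ∀ {x} n → x ≢ 0# → x ^ n ≢ 0#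
  ^-nonzero zero    x≢0 e = 0≢1 (sym e)
  ^-nonzero (suc n) x≢0   = ·-nonzero x≢0 (^-nonzero n x≢0)

record Enumeration {n} (P : Fin n → Set) : Set where
  field
    size      : ℕ
    element   : Fin size → Fin n
    injective : ∀ {i j} → element i ≡ element j → i ≡ j
    sound     : ∀ i → P (element i)
    complete  : ∀ {x} → P x → ∃ λ i → element i ≡ x

enumerate : ∀ {n} {P : Fin n → Set} → Decidable P → Enumeration P
enumerate {zero}      P? = record
  { size = 0 ; element = λ () ; injective = λ { {()} } ; sound = λ () ; complete = λ { {()} } }
enumerate {suc n} {P} P? with enumerate (P? ∘ suc) | P? zero
... | E | no ¬P0 = record
  { size      = size
  ; element   = suc ∘ element
  ; injective = injective ∘ suc-injective
  ; sound     = sound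
  ; complete  = λ { {zero} P0 → contradiction P0 ¬P0
                  ; {suc x} Px → proj₁ (complete Px) , cong suc (proj₂ (complete Px)) }
  } where open Enumeration E
... | E | yes P0 = record
  { size      = suc size
  ; element   = λ { zero → zero ; (suc i) → suc (element i) }
  ; injective = λ { {zero} {zero} _ → refl ; {suc i} {suc j} e → cong suc (injective (suc-injective e)) }
  ; sound     = λ { zero → P0 ; (suc i) → sound i }
  ; complete  = λ { {zero} _ → zero , refl
                  ; {suc x} Px → suc (proj₁ (complete Px)) , cong suc (proj₂ (complete Px)) }
  } where open Enumeration E

-- Finite fields: the multiplicative group and roots of polynomials.

module FieldBasics {n} (F : FiniteField (suc n)) where
  open FiniteField F
  open RingOps isCommutativeRing public

  unit : ∀ x → x ≢ 0# → ∃ λ y → x · y ≡ 1#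
  unit x x≢0 = (x ⁻¹) , ⁻¹-inverse x x≢0

  open Units isCommutativeRing 0≢1 unit public

  private
    module ∏ = Algebra.Properties.CommutativeMonoid.Sum
      (CommutativeRing.*-commutativeMonoid commutativeRing)
    open ∏ using () renaming (sum to ∏)

    nonzero : Fin n → Fin (suc n)
    nonzero = punchIn 0#

    nonzero≢0 : ∀ i → nonzero i ≢ 0#
    nonzero≢0 = punchInᵢ≢i 0#

    ∏≢0 : ∀ {m} (f : Fin m → Fin (suc n)) → (∀ i → f i ≢ 0#) → ∏ f ≢ 0#
    ∏≢0 {zero}  f f≢0 e = 0≢1 (sym e)
    ∏≢0 {suc m} f f≢0   = ·-nonzero (f≢0 zero) (∏≢0 (f ∘ suc) (f≢0 ∘ suc))

    scale : ∀ {x} → x ≢ 0# → Fin n → Fin n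
    scale {x} x≢0 i = punchOut {i = 0#} {j = x · nonzero i} (·-nonzero x≢0 (nonzero≢0 i) ∘ sym)

    nonzero-scale : ∀ {x} (x≢0 : x ≢ 0#) i → nonzero (scale x≢0 i) ≡ x · nonzero i
    nonzero-scale x≢0 i = punchIn-punchOut _

    scale-scale : ∀ {x y} (x≢0 : x ≢ 0#) (y≢0 : y ≢ 0#) → x · y ≡ 1# → ∀ i → scale x≢0 (scale y≢0 i) ≡ i
    scale-scale {x} {y} x≢0 y≢0 xy≡1 i = punchIn-injective 0# _ _ (begin
      nonzero (scale x≢0 (scale y≢0 i)) ≡⟨ nonzero-scale x≢0 _ ⟩
      x · nonzero (scale y≢0 i)         ≡⟨ cong (x ·_) (nonzero-scale y≢0 i) ⟩
      x · (y · nonzero i)               ≡⟨ *-assoc x y _ ⟨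
      (x · y) · nonzero i               ≡⟨ cong (_· nonzero i) xy≡1 ⟩
      1# · nonzero i                    ≡⟨ *-identityˡ _ ⟩
      nonzero i                         ∎)
      where open ≡-Reasoning

  -- Multiplication by x permutes the nonzero elements, so their product P satisfies x^n P = P, and
  -- P is nonzero.
  x^[q-1]≡1 : ∀ {x} → x ≢ 0# → x ^ n ≡ 1#
  x^[q-1]≡1 {x} x≢0 = ·-cancelʳ (∏≢0 nonzero nonzero≢0) (begin
    (x ^ n) · ∏ nonzero                 ≡⟨ cong (_· ∏ nonzero) (∏.sum-replicate n) ⟨
    ∏ {n} (λ _ → x) · ∏ nonzero         ≡⟨ ∏.∑-distrib-+ (λ _ → x) nonzero ⟨
    ∏ (λ i → x · nonzero i)             ≡⟨ ∏.sum-cong-≗ (nonzero-scale x≢0) ⟨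
    ∏ (λ i → nonzero (scale x≢0 i))     ≡⟨ ∏.sum-permute nonzero π ⟨
    ∏ nonzero                           ≡⟨ *-identityˡ _ ⟨
    1# · ∏ nonzero                      ∎)
    where
    open ≡-Reasoning
    x⁻¹≢0 : x ⁻¹ ≢ 0#
    x⁻¹≢0 e = 0≢1 (trans (sym (zeroʳ x)) (trans (cong (x ·_) (sym e)) (⁻¹-inverse x x≢0)))
    π : Permutation′ n
    π = permutation (scale x≢0) (scale x⁻¹≢0)
      (scale-scale x≢0 x⁻¹≢0 (⁻¹-inverse x x≢0))
      (scale-scale x⁻¹≢0 x≢0 (trans (*-comm (x ⁻¹) x) (⁻¹-inverse x x≢0)))

  x^q≡x : ∀ x → x ^ suc n ≡ x
  x^q≡x x with x ≟ᶠ 0#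
  ... | yes refl = zeroˡ _
  ... | no x≢0   = trans (cong (x ·_) (x^[q-1]≡1 x≢0)) (*-identityʳ x)

  -- `FiniteField` records only the order, so the characteristic is read off from it: raising -1 to
  -- an even power gives 1, whereas raising it to the power q gives -1.
  even⇒1+1≡0 : ∀ m → suc n ≡ 2 ℕ.* m → 1# + 1# ≡ 0#
  even⇒1+1≡0 m q≡2m = begin
    1# + 1#                     ≡⟨ cong (_+ 1#) 1≡-1 ⟩
    (- 1#) + 1#                 ≡⟨ CommutativeRing.-‿inverseˡ commutativeRing 1# ⟩
    0#                          ∎
    where
    open ≡-Reasoning
    open Algebra.Properties.Ring (CommutativeRing.ring commutativeRing) using (-1*x≈-x; -‿involutive)
    1≡-1 : 1# ≡ - 1#
    1≡-1 = begin
      1#                        ≡⟨ 1^ m ⟨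
      1# ^ m                    ≡⟨ cong (_^ m) (-‿involutive 1#) ⟨
      (- (- 1#)) ^ m            ≡⟨ cong (_^ m) (trans (cong ((- 1#) ·_) (*-identityʳ (- 1#))) (-1*x≈-x (- 1#))) ⟨
      ((- 1#) ^ 2) ^ m          ≡⟨ ^-assocʳ (- 1#) 2 m ⟩
      (- 1#) ^ (2 ℕ.* m)        ≡⟨ cong ((- 1#) ^_) q≡2m ⟨
      (- 1#) ^ suc n            ≡⟨ x^q≡x (- 1#) ⟩
      - 1#                      ∎

module EvenField {n} (F : FiniteField (suc n)) (1+1≡0 : FiniteField._+_ F (FiniteField.1# F) (FiniteField.1# F) ≡ FiniteField.0# F) where
  open FiniteField F public
  open FieldBasics F using (unit; ·-nonzero; ·-cancelʳ; ^-nonzero; x^q≡x; x^[q-1]≡1) public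
  open Char2 isCommutativeRing 1+1≡0 public

  -- Monic polynomials, given by their lower coefficients, constant term first.
  monic : ∀ {d} → Vec (Fin (suc n)) d → Fin (suc n) → Fin (suc n)
  monic []       x = 1#
  monic (c ∷ cs) x = c + (x · monic cs x)

  -- Synthetic division: the lower coefficients of the quotient are the Horner values of the tails
  -- of `cs` at `a`.
  divide-linear : ∀ {d} (cs : Vec (Fin (suc n)) (suc d)) a → Σ (Vec (Fin (suc n)) d) λ ds →
                  ∀ x → monic cs x + monic cs a ≡ (x + a) · monic ds x
  divide-linear (c ∷ [])         a = [] , λ x →
    solve 4 (λ c x a u → (c :+ x :* u) :+ (c :+ a :* u) := (x :+ a) :* u) refl c x a 1#
  divide-linear (c ∷ cs@(_ ∷ _)) a with ds , eq ← divide-linear cs a = monic cs a ∷ ds , λ x → begin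
    (c + (x · monic cs x)) + (c + (a · monic cs a))
      ≡⟨ solve 5 (λ c x a e f → (c :+ x :* e) :+ (c :+ a :* f) := x :* (e :+ f) :+ (x :+ a) :* f) refl c x a (monic cs x) (monic cs a) ⟩
    (x · (monic cs x + monic cs a)) + ((x + a) · monic cs a)
      ≡⟨ cong (λ e → (x · e) + ((x + a) · monic cs a)) (eq x) ⟩
    (x · ((x + a) · monic ds x)) + ((x + a) · monic cs a)
      ≡⟨ solve 4 (λ x y d f → x :* (y :* d) :+ y :* f := y :* (f :+ x :* d)) refl x (x + a) (monic ds x) (monic cs a) ⟩
    (x + a) · (monic cs a + (x · monic ds x)) ∎
    where open ≡-Reasoning

  -- If the first point is a root, its linear factor is divided out. That factor is nonzero at all
  -- later points by injectivity, so a nonroot of the quotient among them is a nonroot of the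
  -- polynomial.
  monic-nonroot : ∀ {d} (cs : Vec (Fin (suc n)) d) (r : Fin (suc d) → Fin (suc n)) →
                  (∀ {i j} → r i ≡ r j → i ≡ j) → ∃ λ i → monic cs (r i) ≢ 0#
  monic-nonroot [] r r-inj = zero , 0≢1 ∘ sym
  monic-nonroot cs@(_ ∷ _) r r-inj with monic cs (r zero) ≟ᶠ 0#
  ... | no  p≢0 = zero , p≢0
  ... | yes p≡0 with ds , eq ← divide-linear cs (r zero)
                with i , nr ← monic-nonroot ds (r ∘ suc) (suc-injective ∘ r-inj) = suc i , λ p≡0′ →
    ·-nonzero (λ e → contradiction (r-inj (x+y≡0⇒x≡y e)) λ ()) nr
      (trans (sym (eq (r (suc i)))) (trans (cong₂ _+_ p≡0′ p≡0) (x+x≡0 0#)))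

  -- The polynomial X^e + 1 has at most e roots, and e + 1 distinct nonzero elements are available.
  ∃x^e≢1 : ∀ {e} → 0 < e → e < n → ∃ λ x → x ≢ 0# × x ^ e ≢ 1#
  ∃x^e≢1 {suc e} _ e<n =
    let i , nr = monic-nonroot (1# ∷ replicate e 0#) r r-inj in
    r i , punchInᵢ≢i 0# _ , λ x^e≡1 →
      nr (trans (cong (1# +_) (trans (cong (r i ·_) (monomial e (r i))) x^e≡1)) 1+1≡0)
    where
    r : Fin (suc (suc e)) → Fin (suc n)
    r i = punchIn 0# (inject≤ i e<n)
    r-inj : ∀ {i j} → r i ≡ r j → i ≡ j
    r-inj = inject≤-injective e<n e<n _ _ ∘ punchIn-injective 0# _ _
    monomial : ∀ e x → monic (replicate e 0#) x ≡ x ^ e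
    monomial zero    x = refl
    monomial (suc e) x = trans (+-identityˡ _) (cong (x ·_) (monomial e x))

-- The subfield F₀ as the fixed field of x ↦ x^s, and the basis 1, ω of F over it.

square≤⇒≤ : ∀ {m n} → m ℕ.* m ≤ n ℕ.* n → m ≤ n
square≤⇒≤ {m} {n} mm≤nn with ℕₚ.≤-total m n
... | inj₁ m≤n = m≤n
... | inj₂ n≤m = ℕₚ.≮⇒≥ λ n<m → ℕₚ.<⇒≱ (ℕₚ.*-mono-< n<m n<m) mm≤nn

2^k-even : ∀ {k} → 0 < k → ∃ λ m → 2 ℕ.^ k ≡ 2 ℕ.* m
2^k-even {suc k} _ = 2 ℕ.^ k , refl

squares-gap : ∀ {m n} → suc n ≡ suc (suc m) ℕ.* suc (suc m) → suc m < n
squares-gap {m} {n} e = subst (suc m <_) (sym (ℕₚ.suc-injective e))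
  (ℕₚ.<-≤-trans (ℕₚ.m<m*n (suc m) (suc (suc m)) (s≤s (s≤s z≤n))) (ℕₚ.m≤n+m _ (suc m)))

module QuadraticExtension {n} (F : FiniteField (suc n)) (k : ℕ) (0<k : 0 < k) (q≡ss : suc n ≡ 2 ℕ.^ k ℕ.* 2 ℕ.^ k) where

  A : Set
  A = Fin (suc n)

  s : ℕ
  s = 2 ℕ.^ k

  q-even : ∃ λ m → suc n ≡ 2 ℕ.* m
  q-even = let m , s≡2m = 2^k-even 0<k in
    m ℕ.* s , trans q≡ss (trans (cong (ℕ._* s) s≡2m) (ℕₚ.*-assoc 2 m s))

  s≡2+ : ∃ λ m → s ≡ suc (suc m)
  s≡2+ with s | ℕₚ.^-monoʳ-≤ 2 0<k
  ... | suc (suc m) | s≤s (s≤s _) = m , refl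

  abstract
    1+1≡0 : FiniteField._+_ F (FiniteField.1# F) (FiniteField.1# F) ≡ FiniteField.0# F
    1+1≡0 = FieldBasics.even⇒1+1≡0 F (proj₁ q-even) (proj₂ q-even)

  open EvenField F 1+1≡0 public

  bar : A → A
  bar x = x ^ s

  bar-+ : ∀ x y → bar (x + y) ≡ bar x + bar y
  bar-+ = frobenius^ k

  bar-· : ∀ x y → bar (x · y) ≡ bar x · bar y
  bar-· x y = ^-distrib-* x y s

  bar-bar : ∀ x → bar (bar x) ≡ x
  bar-bar x = trans (^-assocʳ x s s) (trans (cong (x ^_) (sym q≡ss)) (x^q≡x x))

  bar-0 : bar 0# ≡ 0#
  bar-0 with s | s≡2+
  ... | _ | m , refl = zeroˡ _

  Fixed : A → Set
  Fixed x = bar x ≡ x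

  Fixed-+ : ∀ {x y} → Fixed x → Fixed y → Fixed (x + y)
  Fixed-+ {x} {y} fx fy = trans (bar-+ x y) (cong₂ _+_ fx fy)

  Fixed-· : ∀ {x y} → Fixed x → Fixed y → Fixed (x · y)
  Fixed-· {x} {y} fx fy = trans (bar-· x y) (cong₂ _·_ fx fy)

  private
    -- An element fixed by `bar` and nonzero is a root of X^(s-1) + 1, and s - 1 < q - 1, so not all
    -- nonzero elements are fixed.
    moved : ∃ λ θ → bar θ + θ ≢ 0#
    moved =
      let m , s≡ = s≡2+
          θ , θ≢0 , θ^≢1 = ∃x^e≢1 {suc m} (s≤s z≤n) (squares-gap (trans q≡ss (cong (λ s → s ℕ.* s) s≡)))
      in θ , λ e → θ^≢1 (·-cancelʳ θ≢0 (begin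
        (θ ^ suc m) · θ     ≡⟨ *-comm _ θ ⟩
        θ ^ suc (suc m)     ≡⟨ cong (θ ^_) s≡ ⟨
        bar θ               ≡⟨ x+y≡0⇒x≡y e ⟩
        θ                   ≡⟨ *-identityˡ θ ⟨
        1# · θ              ∎))
      where open ≡-Reasoning

    -- The trace τ of θ over F₀ is fixed by `bar`, hence so is its inverse u, and the trace of θ u
    -- is τ u = 1.
    normalise-trace : ∀ θ u → (bar θ + θ) ≢ 0# → (bar θ + θ) · u ≡ 1# → bar (θ · u) ≡ (θ · u) + 1#
    normalise-trace θ u τ≢0 τu≡1 = begin
      bar (θ · u)                         ≡⟨ bar-· θ u ⟩
      bar θ · bar u                       ≡⟨ cong (bar θ ·_) u-fixed ⟩
      bar θ · u                           ≡⟨ solve 3 (λ θ θ′ u → θ′ :* u := θ :* u :+ (θ′ :+ θ) :* u) refl θ (bar θ) u ⟩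
      (θ · u) + ((bar θ + θ) · u)         ≡⟨ cong ((θ · u) +_) τu≡1 ⟩
      (θ · u) + 1#                        ∎
      where
      open ≡-Reasoning
      τ = bar θ + θ
      τ-fixed : Fixed τ
      τ-fixed = trans (bar-+ (bar θ) θ) (trans (cong (_+ bar θ) (bar-bar θ)) (+-comm θ (bar θ)))
      u-fixed : Fixed u
      u-fixed = ·-cancelʳ τ≢0 (begin
        bar u · τ       ≡⟨ cong (bar u ·_) τ-fixed ⟨
        bar u · bar τ   ≡⟨ bar-· u τ ⟨
        bar (u · τ)     ≡⟨ cong bar (trans (*-comm u τ) τu≡1) ⟩
        bar 1#          ≡⟨ 1^ s ⟩
        1#              ≡⟨ trans (*-comm u τ) τu≡1 ⟨
        u · τ           ∎)

  abstract
    trace-one : ∃ λ ω → bar ω ≡ ω + 1#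
    trace-one = let θ , τ≢0 = moved ; u , τu≡1 = unit _ τ≢0 in (θ · u) , normalise-trace θ u τ≢0 τu≡1

  ω : A
  ω = proj₁ trace-one

  bar-ω : bar ω ≡ ω + 1#
  bar-ω = proj₂ trace-one

  -- The norm ω (ω + 1) of ω over F₀; multiplication in the basis 1, ω is governed by ω² = ω + δ.
  δ : A
  δ = (ω · ω) + ω

  δ-fixed : Fixed δ
  δ-fixed = begin
    bar ((ω · ω) + ω)                       ≡⟨ trans (bar-+ _ _) (cong (_+ bar ω) (bar-· ω ω)) ⟩
    (bar ω · bar ω) + bar ω                 ≡⟨ cong (λ w → (w · w) + w) bar-ω ⟩
    ((ω + 1#) · (ω + 1#)) + (ω + 1#)        ≡⟨ solve 1 (λ w → (w :+ con true) :* (w :+ con true) :+ (w :+ con true) := w :* w :+ w) refl ω ⟩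
    (ω · ω) + ω                             ∎
    where open ≡-Reasoning

  -- 0 and 1 are fixed by `bar` while ω is sent to ω + 1, so both factors of ω (ω + 1) are nonzero.
  δ≢0 : δ ≢ 0#
  δ≢0 = ·-nonzero ω≢0 ω≢1 ∘ trans (solve 1 (λ w → w :* (w :+ con true) := w :* w :+ w) refl ω)
    where
    ω≢0 : ω ≢ 0#
    ω≢0 e = 0≢1 (trans (sym bar-0) (trans (cong bar (sym e)) (trans bar-ω (trans (cong (_+ 1#) e) (+-identityˡ 1#)))))
    ω≢1 : ω + 1# ≢ 0#
    ω≢1 e = 0≢1 (trans (sym e) (trans (sym bar-ω) (trans (cong bar (x+y≡0⇒x≡y e)) (1^ s))))

  abstract
    -- Conjugation adds x + `bar x` to x and, for fixed b, adds b to ω b. With b = x + `bar x` the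
    -- two changes cancel in x + ω b.
    coordinates : ∀ x → ∃ λ a → ∃ λ b → Fixed a × Fixed b × x ≡ a + (ω · b)
    coordinates x = a , b , a-fixed , b-fixed , solve 2 (λ x wb → x := (x :+ wb) :+ wb) refl x (ω · b)
      where
      open ≡-Reasoning
      a b : A
      b = x + bar x
      a = x + (ω · b)
      b-fixed : Fixed b
      b-fixed = trans (bar-+ x (bar x)) (trans (cong (bar x +_) (bar-bar x)) (+-comm (bar x) x))
      a-fixed : Fixed a
      a-fixed = begin
        bar a                           ≡⟨ trans (bar-+ x _) (cong (bar x +_) (bar-· ω b)) ⟩
        bar x + (bar ω · bar b)         ≡⟨ cong₂ (λ w c → bar x + (w · c)) bar-ω b-fixed ⟩
        bar x + ((ω + 1#) · b)          ≡⟨ solve 3 (λ x y w → y :+ (w :+ con true) :* (x :+ y) := x :+ w :* (x :+ y)) refl x (bar x) ω ⟩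
        a                               ∎

  -- Adding the conjugate relation a + (ω + 1) b = 0 leaves b = 0.
  independent : ∀ {a b} → Fixed a → Fixed b → a + (ω · b) ≡ 0# → a ≡ 0# × b ≡ 0#
  independent {a} {b} fa fb e = a≡0 , b≡0
    where
    open ≡-Reasoning
    b≡0 : b ≡ 0#
    b≡0 = begin
      b                                         ≡⟨ solve 3 (λ a b w → b := (a :+ (w :+ con true) :* b) :+ (a :+ w :* b)) refl a b ω ⟩
      (a + ((ω + 1#) · b)) + (a + (ω · b))      ≡⟨ cong₂ (λ u v → u + v) conj e ⟩
      0# + 0#                                   ≡⟨ x+x≡0 0# ⟩
      0#                                        ∎
      where
      conj : a + ((ω + 1#) · b) ≡ 0#
      conj = begin
        a + ((ω + 1#) · b)        ≡⟨ cong₂ (λ c w → c + (w · b)) fa bar-ω ⟨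
        bar a + (bar ω · b)       ≡⟨ cong (λ c → bar a + (bar ω · c)) fb ⟨
        bar a + (bar ω · bar b)   ≡⟨ trans (bar-+ a _) (cong (bar a +_) (bar-· ω b)) ⟨
        bar (a + (ω · b))         ≡⟨ cong bar e ⟩
        bar 0#                    ≡⟨ bar-0 ⟩
        0#                        ∎
    a≡0 : a ≡ 0#
    a≡0 = begin
      a                 ≡⟨ solve 3 (λ a b w → a := (a :+ w :* b) :+ w :* b) refl a b ω ⟩
      (a + (ω · b)) + (ω · b)   ≡⟨ cong₂ (λ u v → u + (ω · v)) e b≡0 ⟩
      0# + (ω · 0#)     ≡⟨ trans (+-identityˡ _) (zeroʳ ω) ⟩
      0#                ∎

  coordinates-unique : ∀ {a b c d} → Fixed a → Fixed b → Fixed c → Fixed d →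
                       a + (ω · b) ≡ c + (ω · d) → a ≡ c × b ≡ d
  coordinates-unique {a} {b} {c} {d} fa fb fc fd e =
    let a+c≡0 , b+d≡0 = independent (Fixed-+ fa fc) (Fixed-+ fb fd) (begin
          (a + c) + (ω · (b + d))           ≡⟨ solve 5 (λ a b c d w → (a :+ c) :+ w :* (b :+ d) := (a :+ w :* b) :+ (c :+ w :* d)) refl a b c d ω ⟩
          (a + (ω · b)) + (c + (ω · d))     ≡⟨ cong (_+ (c + (ω · d))) e ⟩
          (c + (ω · d)) + (c + (ω · d))     ≡⟨ x+x≡0 _ ⟩
          0#                                ∎)
    in x+y≡0⇒x≡y a+c≡0 , x+y≡0⇒x≡y b+d≡0
    where open ≡-Reasoning

  abstract
    fixedPoints : Enumeration Fixed
    fixedPoints = enumerate (λ x → bar x ≟ᶠ x)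

  private
    open Enumeration fixedPoints

    -- Coordinates in the basis 1, ω embed the s² elements of F into pairs of fixed points. The
    -- bound lets `ι` pick s distinct elements of F₀.
    s≤size : s ≤ size
    s≤size = square≤⇒≤ (subst (_≤ size ℕ.* size) q≡ss (injective⇒≤ {f = index} index-inj))
      where
      index : A → Fin (size ℕ.* size)
      index x = let a , b , fa , fb , _ = coordinates x in combine (proj₁ (complete fa)) (proj₁ (complete fb))
      index-inj : ∀ {x y} → index x ≡ index y → x ≡ y
      index-inj {x} {y} e =
        let a , b , fa , fb , x≡ = coordinates x
            c , d , fc , fd , y≡ = coordinates y
            i≡ , j≡ = combine-injective _ _ _ _ e
            a≡c = trans (sym (proj₂ (complete fa))) (trans (cong element i≡) (proj₂ (complete fc)))
            b≡d = trans (sym (proj₂ (complete fb))) (trans (cong element j≡) (proj₂ (complete fd)))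
        in trans x≡ (trans (cong₂ (λ a b → a + (ω · b)) a≡c b≡d) (sym y≡))

  ι : Fin s → A
  ι i = element (inject≤ i s≤size)

  ι-injective : ∀ {i j} → ι i ≡ ι j → i ≡ j
  ι-injective = inject≤-injective s≤size s≤size _ _ ∘ injective

  ι-fixed : ∀ i → Fixed (ι i)
  ι-fixed i = sound _

-- Sets with injective secant maps, and their construction in F³ from a semilinear map.

remQuot-injective : ∀ {m} n {i j : Fin (m ℕ.* n)} → remQuot {m} n i ≡ remQuot n j → i ≡ j
remQuot-injective {m} n {i} {j} e =
  trans (sym (combine-remQuot {m} n i)) (trans (cong (uncurry combine) e) (combine-remQuot {m} n j))

module Families {n} (F : FiniteField (suc n)) (k : ℕ) (0<k : 0 < k) (q≡ss : suc n ≡ 2 ℕ.^ k ℕ.* 2 ℕ.^ k) where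
  open QuadraticExtension F k 0<k q≡ss

  -- The minus sign is kept, although the characteristic is 2, so that this agrees by definition
  -- with the coordinates in `Collinear`.
  line : A → A → A → A
  line a l b = a + (l · (b + (- a)))

  -- In characteristic 2 the point on the secant is (l + 1) a + l b, so the two sides only involve
  -- differences.
  line-injective : ∀ {l a b a′ b′} → line a l b ≡ line a′ l b′ → (l + 1#) · (a + a′) ≡ l · (b + b′)
  line-injective {l} {a} {b} {a′} {b′} e = x+y≡0⇒x≡y (begin
    ((l + 1#) · (a + a′)) + (l · (b + b′))
      ≡⟨ solve 5 (λ l a b a′ b′ → (l :+ con true) :* (a :+ a′) :+ l :* (b :+ b′)
           := (a :+ l :* (b :+ :- a)) :+ (a′ :+ l :* (b′ :+ :- a′))) refl l a b a′ b′ ⟩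
    line a l b + line a′ l b′     ≡⟨ cong (_+ line a′ l b′) e ⟩
    line a′ l b′ + line a′ l b′   ≡⟨ x+x≡0 _ ⟩
    0#                            ∎)
    where open ≡-Reasoning

  record Family (r : ℕ) : Set where
    field
      size      : ℕ
      size≡     : size ≡ s ℕ.^ r
      member    : Fin size → Fin r → A
      separated : ∀ {l} → l ≢ 0# → l ≢ 1# → ∀ i j i′ j′ →
                  (∀ c → line (member i c) l (member j c) ≡ line (member i′ c) l (member j′ c)) →
                  i ≡ i′ × j ≡ j′

  V : Set
  V = A × A × A

  infixl 6 _⊕_
  infixr 7 _⊙_

  _⊕_ : V → V → V
  (x , y , z) ⊕ (x′ , y′ , z′) = (x + x′) , (y + y′) , (z + z′)

  _⊙_ : A → V → V
  a ⊙ (x , y , z) = (a · x) , (a · y) , (a · z)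

  0V : V
  0V = 0# , 0# , 0#

  FixedV : V → Set
  FixedV (x , y , z) = Fixed x × Fixed y × Fixed z

  ext : ∀ {x y z x′ y′ z′ : A} → x ≡ x′ → y ≡ y′ → z ≡ z′ → (x , y , z) ≡ (x′ , y′ , z′)
  ext refl refl refl = refl

  ⊕≡0⇒≡ : ∀ {u v} → u ⊕ v ≡ 0V → u ≡ v
  ⊕≡0⇒≡ e = ext (x+y≡0⇒x≡y (cong proj₁ e)) (x+y≡0⇒x≡y (cong (proj₁ ∘ proj₂) e)) (x+y≡0⇒x≡y (cong (proj₂ ∘ proj₂) e))

  -- Vectors over F₀ are kept as vectors over F satisfying `FixedV`; hence S acts on all of F³, and
  -- `S-fixed` says that it restricts to F₀³.
  record Twist : Set where
    field
      σ           : ℕ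
      S           : V → V
      S-⊕         : ∀ u v → S (u ⊕ v) ≡ S u ⊕ S v
      S-⊙         : ∀ a v → S (a ⊙ v) ≡ (a ^ σ) ⊙ S v
      S-fixed     : ∀ {v} → FixedV v → FixedV (S v)
      σ-fixed     : ∀ {a} → a ^ σ ≡ a → a ≡ 0# ⊎ a ≡ 1#
      S-kernel    : ∀ {v} → S v ≡ 0V → v ≡ 0V
      irreducible : ∀ {c₀ c₁ v} → c₀ ≢ 0# → S (S v) ≡ c₁ ⊙ S v ⊕ c₀ ⊙ v → v ≡ 0V

  module FromTwist (T : Twist) where
    open Twist T

    graph : V → V
    graph v = v ⊕ ω ⊙ S v

    graph-⊕ : ∀ u v → graph (u ⊕ v) ≡ graph u ⊕ graph v
    graph-⊕ u v = trans (cong (λ w → (u ⊕ v) ⊕ ω ⊙ w) (S-⊕ u v)) (ext (e _ _ _ _) (e _ _ _ _) (e _ _ _ _))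
      where
      e : ∀ x y z w → (x + y) + (ω · (z + w)) ≡ (x + (ω · z)) + (y + (ω · w))
      e x y z w = solve 5 (λ x y z w o → (x :+ y) :+ o :* (z :+ w) := (x :+ o :* z) :+ (y :+ o :* w)) refl x y z w ω

    FixedV-⊕ : ∀ {u v} → FixedV u → FixedV v → FixedV (u ⊕ v)
    FixedV-⊕ (x , y , z) (x′ , y′ , z′) = Fixed-+ x x′ , Fixed-+ y y′ , Fixed-+ z z′

    ⊙-zero : ∀ {a v} → a ≢ 0# → a ⊙ v ≡ 0V → v ≡ 0V
    ⊙-zero {a} {v} a≢0 e = ext (c (cong proj₁ e)) (c (cong (proj₁ ∘ proj₂) e)) (c (cong (proj₂ ∘ proj₂) e))
      where
      c : ∀ {x} → a · x ≡ 0# → x ≡ 0#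
      c {x} e = ·-cancelʳ a≢0 (trans (*-comm x a) (trans e (sym (zeroˡ a))))

    -- With λ = a + ωb, comparing coordinates in λ (v + ω S v) = w + ω S w gives w and S w.
    module _ {a b : A} (fa : Fixed a) (fb : Fixed b) where
      compare : ∀ {x y z w} → Fixed x → Fixed y → Fixed z → Fixed w →
                (a + (ω · b)) · (x + (ω · y)) ≡ z + (ω · w) →
                ((a · x) + ((b · δ) · y) ≡ z) × ((b · x) + ((a + b) · y) ≡ w)
      compare {x} {y} {z} {w} fx fy fz fw e = coordinates-unique
        (Fixed-+ (Fixed-· fa fx) (Fixed-· (Fixed-· fb δ-fixed) fy))
        (Fixed-+ (Fixed-· fb fx) (Fixed-· (Fixed-+ fa fb) fy)) fz fw
        (trans (solve 5 (λ o a b x y → (a :* x :+ (b :* (o :* o :+ o)) :* y) :+ o :* (b :* x :+ (a :+ b) :* y)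
                           := (a :+ o :* b) :* (x :+ o :* y)) refl ω a b x y) e)

      compareV : ∀ {v w} → FixedV v → FixedV w → (a + (ω · b)) ⊙ graph v ≡ graph w →
                 (a ⊙ v ⊕ (b · δ) ⊙ S v ≡ w) × (b ⊙ v ⊕ (a + b) ⊙ S v ≡ S w)
      compareV (f₁ , f₂ , f₃) (g₁ , g₂ , g₃) e =
        let h₁ , h₂ , h₃ = S-fixed (f₁ , f₂ , f₃)
            k₁ , k₂ , k₃ = S-fixed (g₁ , g₂ , g₃)
            p₁ , q₁ = compare f₁ h₁ g₁ k₁ (cong proj₁ e)
            p₂ , q₂ = compare f₂ h₂ g₂ k₂ (cong (proj₁ ∘ proj₂) e)
            p₃ , q₃ = compare f₃ h₃ g₃ k₃ (cong (proj₂ ∘ proj₂) e)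
        in ext p₁ p₂ p₃ , ext q₁ q₂ q₃

      -- Two expressions for S w, one from applying S to the formula for w and one from the
      -- ω-coordinate. Equating them eliminates w and leaves a relation between v, S v and S² v.
      twisted : ∀ {v w} → FixedV v → FixedV w → (a + (ω · b)) ⊙ graph v ≡ graph w →
                (a ^ σ) ⊙ S v ⊕ ((b · δ) ^ σ) ⊙ S (S v) ≡ b ⊙ v ⊕ (a + b) ⊙ S v
      twisted {v} fv fw e = let p , q = compareV fv fw e in
        trans (sym (trans (S-⊕ _ _) (cong₂ _⊕_ (S-⊙ a v) (S-⊙ (b · δ) (S v))))) (trans (cong S p) (sym q))

    -- Here w = a v, and S w equals both a S v, by coordinates, and a^σ S v, by semilinearity. As
    -- a^σ ≠ a, this forces S v = 0.
    fixed-scattered : ∀ {a v w} → a ≢ 0# → a ≢ 1# → Fixed a → FixedV v → FixedV w → a ⊙ graph v ≡ graph w → v ≡ 0V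
    fixed-scattered {a} {v} {w} a≢0 a≢1 fa fv fw e = S-kernel (⊙-zero a^σ+a≢0 (begin
      ((a ^ σ) + a) ⊙ S v           ≡⟨ ext (*+ _) (*+ _) (*+ _) ⟩
      (a ^ σ) ⊙ S v ⊕ a ⊙ S v       ≡⟨ cong₂ _⊕_ (trans (sym (S-⊙ a v)) (cong S p)) q ⟩
      S w ⊕ S w                     ≡⟨ ext (x+x≡0 _) (x+x≡0 _) (x+x≡0 _) ⟩
      0V                            ∎))
      where
      open ≡-Reasoning
      *+ : ∀ x → ((a ^ σ) + a) · x ≡ ((a ^ σ) · x) + (a · x)
      *+ x = solve 3 (λ a t x → (t :+ a) :* x := t :* x :+ a :* x) refl a (a ^ σ) x
      a^σ+a≢0 : (a ^ σ) + a ≢ 0#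
      a^σ+a≢0 z = [ a≢0 , a≢1 ] (σ-fixed (x+y≡0⇒x≡y z))
      a+ω0 : a + (ω · 0#) ≡ a
      a+ω0 = trans (cong (a +_) (zeroʳ ω)) (+-identityʳ a)
      pq : (a ⊙ v ⊕ (0# · δ) ⊙ S v ≡ w) × (0# ⊙ v ⊕ (a + 0#) ⊙ S v ≡ S w)
      pq = compareV fa bar-0 fv fw (trans (cong (_⊙ graph v) a+ω0) e)
      p : a ⊙ v ≡ w
      p = trans (ext (r _ _) (r _ _) (r _ _)) (proj₁ pq)
        where r : ∀ x y → a · x ≡ (a · x) + ((0# · δ) · y)
              r x y = solve 4 (λ a d x y → a :* x := a :* x :+ (con false :* d) :* y) refl a δ x y
      q : a ⊙ S v ≡ S w
      q = trans (ext (r _ _) (r _ _) (r _ _)) (proj₂ pq)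
        where r : ∀ x y → a · y ≡ (0# · x) + ((a + 0#) · y)
              r x y = solve 3 (λ a x y → a :* y := con false :* x :+ (a :+ con false) :* y) refl a x y

    -- Since b δ ≠ 0, the relation `twisted` can be solved for S² v. The coefficient of v becomes
    -- b/(b δ)^σ, which is nonzero, so `irreducible` applies.
    moved-scattered : ∀ {a b v w} → b ≢ 0# → Fixed a → Fixed b → FixedV v → FixedV w →
                      (a + (ω · b)) ⊙ graph v ≡ graph w → v ≡ 0V
    moved-scattered {a} {b} {v} {w} b≢0 fa fb fv fw e = irreducible (·-nonzero u≢0 b≢0)
      (ext (r _ _ _ (cong proj₁ t)) (r _ _ _ (cong (proj₁ ∘ proj₂) t)) (r _ _ _ (cong (proj₂ ∘ proj₂) t)))
      where
      B = (b · δ) ^ σ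
      u = proj₁ (unit B (^-nonzero σ (·-nonzero b≢0 δ≢0)))
      Bu≡1 : B · u ≡ 1#
      Bu≡1 = proj₂ (unit B (^-nonzero σ (·-nonzero b≢0 δ≢0)))
      t = twisted fa fb fv fw e
      u≢0 : u ≢ 0#
      u≢0 u≡0 = 0≢1 (trans (sym (zeroʳ B)) (trans (cong (B ·_) (sym u≡0)) Bu≡1))
      r : ∀ x y z → ((a ^ σ) · y) + (B · z) ≡ (b · x) + ((a + b) · y) →
          z ≡ ((u · (((a ^ σ) + a) + b)) · y) + ((u · b) · x)
      r x y z e = begin
        z                   ≡⟨ *-identityˡ z ⟨
        1# · z              ≡⟨ cong (_· z) Bu≡1 ⟨
        (B · u) · z         ≡⟨ solve 5 (λ t B u y z → (B :* u) :* z := u :* (t :* y) :+ u :* (t :* y :+ B :* z)) refl (a ^ σ) B u y z ⟩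
        (u · ((a ^ σ) · y)) + (u · (((a ^ σ) · y) + (B · z)))   ≡⟨ cong (λ w → (u · ((a ^ σ) · y)) + (u · w)) e ⟩
        (u · ((a ^ σ) · y)) + (u · ((b · x) + ((a + b) · y)))   ≡⟨ solve 6 (λ a b t u x y → u :* (t :* y) :+ u :* (b :* x :+ (a :+ b) :* y)
                                                                      := (u :* (t :+ a :+ b)) :* y :+ (u :* b) :* x) refl a b (a ^ σ) u x y ⟩
        ((u · (((a ^ σ) + a) + b)) · y) + ((u · b) · x)   ∎
        where open ≡-Reasoning

    graph-scattered : ∀ {l v w} → l ≢ 0# → l ≢ 1# → FixedV v → FixedV w → l ⊙ graph v ≡ graph w → v ≡ 0V
    graph-scattered {l} {v} {w} l≢0 l≢1 fv fw e =
      let a , b , fa , fb , l≡ = coordinates l in split fa fb l≡ (b ≟ᶠ 0#)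
      where
      split : ∀ {a b} → Fixed a → Fixed b → l ≡ a + (ω · b) → Dec (b ≡ 0#) → v ≡ 0V
      split fa fb l≡ (no b≢0) = moved-scattered b≢0 fa fb fv fw (trans (cong (_⊙ graph v) (sym l≡)) e)
      split {a} {b} fa fb l≡ (yes b≡0) = fixed-scattered (l≢0 ∘ trans l≡a) (l≢1 ∘ trans l≡a) fa fv fw
        (trans (cong (_⊙ graph v) (sym l≡a)) e)
        where
        l≡a : l ≡ a
        l≡a = trans l≡ (trans (cong (λ b → a + (ω · b)) b≡0) (trans (cong (a +_) (zeroʳ ω)) (+-identityʳ a)))

    graph-injective : ∀ {v} → FixedV v → graph v ≡ 0V → v ≡ 0V
    graph-injective (f₁ , f₂ , f₃) e = let h₁ , h₂ , h₃ = S-fixed (f₁ , f₂ , f₃) in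
      ext (proj₁ (independent f₁ h₁ (cong proj₁ e))) (proj₁ (independent f₂ h₂ (cong (proj₁ ∘ proj₂) e)))
          (proj₁ (independent f₃ h₃ (cong (proj₂ ∘ proj₂) e)))

    vector : Fin (s ℕ.* (s ℕ.* s)) → V
    vector i = let i₀ , j = remQuot {s} (s ℕ.* s) i ; i₁ , i₂ = remQuot {s} s j in ι i₀ , ι i₁ , ι i₂

    vector-fixed : ∀ i → FixedV (vector i)
    vector-fixed i = ι-fixed _ , ι-fixed _ , ι-fixed _

    vector-injective : ∀ {i j} → vector i ≡ vector j → i ≡ j
    vector-injective e = remQuot-injective (s ℕ.* s) (cong₂ _,_ (ι-injective (cong proj₁ e))
      (remQuot-injective s (cong₂ _,_ (ι-injective (cong (proj₁ ∘ proj₂) e)) (ι-injective (cong (proj₂ ∘ proj₂) e)))))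

    coordinate : V → Fin 3 → A
    coordinate (x , y , z) 0F = x
    coordinate (x , y , z) 1F = y
    coordinate (x , y , z) 2F = z

    -- Dividing `line-injective` by l gives (l⁻¹ + 1) graph (u + u') = graph (v + v'). The scalar is
    -- not 0 because l ≠ 1, and not 1 because l⁻¹ ≠ 0, so scatteredness gives u = u'; then graph (v
    -- + v') = 0.
    graph-separated : ∀ {l} → l ≢ 0# → l ≢ 1# → ∀ {u v u′ v′} → FixedV u → FixedV v → FixedV u′ → FixedV v′ →
      (∀ c → line (coordinate (graph u) c) l (coordinate (graph v) c) ≡ line (coordinate (graph u′) c) l (coordinate (graph v′) c)) →
      u ≡ u′ × v ≡ v′
    graph-separated {l} l≢0 l≢1 {u} {v} {u′} {v′} fu fv fu′ fv′ e =
      ⊕≡0⇒≡ u≡0 , ⊕≡0⇒≡ (graph-injective (FixedV-⊕ fv fv′) (trans (sym scaled) (trans (cong (λ w → (m + 1#) ⊙ graph w) u≡0) graph0)))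
      where
      open ≡-Reasoning
      m : A
      m = proj₁ (unit l l≢0)
      lm≡1 : l · m ≡ 1#
      lm≡1 = proj₂ (unit l l≢0)
      r : ∀ c → (m + 1#) · (coordinate (graph u) c + coordinate (graph u′) c) ≡ coordinate (graph v) c + coordinate (graph v′) c
      r c = begin
        (m + 1#) · x               ≡⟨ cong (λ e → (m + e) · x) lm≡1 ⟨
        (m + (l · m)) · x          ≡⟨ solve 3 (λ l m x → (m :+ l :* m) :* x := m :* ((l :+ con true) :* x)) refl l m x ⟩
        m · ((l + 1#) · x)         ≡⟨ cong (m ·_) (line-injective (e c)) ⟩
        m · (l · y)                ≡⟨ solve 3 (λ l m y → m :* (l :* y) := (l :* m) :* y) refl l m y ⟩
        (l · m) · y                ≡⟨ trans (cong (_· y) lm≡1) (*-identityˡ y) ⟩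
        y                          ∎
        where
        x = coordinate (graph u) c + coordinate (graph u′) c
        y = coordinate (graph v) c + coordinate (graph v′) c
      scaled : (m + 1#) ⊙ graph (u ⊕ u′) ≡ graph (v ⊕ v′)
      scaled = trans (cong ((m + 1#) ⊙_) (graph-⊕ u u′)) (trans (ext (r 0F) (r 1F) (r 2F)) (sym (graph-⊕ v v′)))
      m≢0 : m ≢ 0#
      m≢0 m≡0 = 0≢1 (trans (sym (zeroʳ l)) (trans (cong (l ·_) (sym m≡0)) lm≡1))
      u≡0 : u ⊕ u′ ≡ 0V
      u≡0 = graph-scattered
        (λ z → l≢1 (trans (sym (*-identityʳ l)) (trans (cong (l ·_) (sym (x+y≡0⇒x≡y z))) lm≡1)))
        (λ z → m≢0 (+-cancelʳ (trans z (sym (+-identityˡ 1#)))))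
        (FixedV-⊕ fu fu′) (FixedV-⊕ fv fv′) scaled
      graph0 : (m + 1#) ⊙ graph 0V ≡ 0V
      graph0 = trans (cong ((m + 1#) ⊙_) graph0V) (ext (zeroʳ _) (zeroʳ _) (zeroʳ _))
        where
        graph0V : graph 0V ≡ 0V
        graph0V = begin
          graph 0V                ≡⟨ cong graph (ext (x+x≡0 0#) (x+x≡0 0#) (x+x≡0 0#)) ⟨
          graph (0V ⊕ 0V)         ≡⟨ graph-⊕ 0V 0V ⟩
          graph 0V ⊕ graph 0V     ≡⟨ ext (x+x≡0 _) (x+x≡0 _) (x+x≡0 _) ⟩
          0V                      ∎

    family₃ : Family 3
    family₃ = record
      { size      = s ℕ.* (s ℕ.* s)
      ; size≡     = cong (λ t → s ℕ.* (s ℕ.* t)) (sym (ℕₚ.*-identityʳ s))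
      ; member    = coordinate ∘ graph ∘ vector
      ; separated = λ l≢0 l≢1 i j i′ j′ e →
          let u≡ , v≡ = graph-separated l≢0 l≢1 (vector-fixed i) (vector-fixed j) (vector-fixed i′) (vector-fixed j′) e
          in vector-injective u≡ , vector-injective v≡
      }

-- Points are functions, so their equality has no general decision procedure; for members of a list
-- without repetitions it is settled by their positions.
∈-decidable-≡ : ∀ {A : Set} {xs : List A} {x y} → Unique xs → x ∈ xs → y ∈ xs → x ≡ y ⊎ x ≢ y
∈-decidable-≡ _            (here refl) (here refl) = inj₁ refl
∈-decidable-≡ (x≢ ∷ _)     (here refl) (there y∈)  = inj₂ (All.lookup x≢ y∈)
∈-decidable-≡ (y≢ ∷ _)     (there x∈)  (here refl) = inj₂ (All.lookup y≢ x∈ ∘ sym)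
∈-decidable-≡ (_ ∷ unique) (there x∈)  (there y∈)  = ∈-decidable-≡ unique x∈ y∈

square-^ : ∀ m r → (m ℕ.* m) ℕ.^ r ≡ m ℕ.^ r ℕ.* m ℕ.^ r
square-^ m zero    = refl
square-^ m (suc r) = trans (cong (m ℕ.* m ℕ.*_) (square-^ m r)) (ℕₚ.[m*n]*[o*p]≡[m*o]*[n*p] m m (m ℕ.^ r) (m ℕ.^ r))

-- From injective secant maps to complete caps.

module Caps {n} (F : FiniteField (suc n)) (k : ℕ) (0<k : 0 < k) (q≡ss : suc n ≡ 2 ℕ.^ k ℕ.* 2 ℕ.^ k) where
  open QuadraticExtension F k 0<k q≡ss
  open Families F k 0<k q≡ss

  addParabola : ∀ {r} → Family r → Family (suc (suc r))
  addParabola {r} G = record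
    { size      = size ℕ.* suc n
    ; size≡     = trans (ℕₚ.*-comm size (suc n)) (trans (cong₂ ℕ._*_ q≡ss size≡) (ℕₚ.*-assoc s s _))
    ; member    = λ i → member′ (remQuot (suc n) i)
    ; separated = λ l≢0 l≢1 i j i′ j′ e →
        let i≡ , j≡ = separated′ l≢0 l≢1 (remQuot (suc n) i) (remQuot (suc n) j) (remQuot (suc n) i′) (remQuot (suc n) j′) e
        in remQuot-injective (suc n) i≡ , remQuot-injective (suc n) j≡
    }
    where
    open Family G
    member′ : Fin size × A → Fin (suc (suc r)) → A
    member′ (i , y) zero          = y
    member′ (i , y) (suc zero)    = y · y
    member′ (i , y) (suc (suc c)) = member i c
    -- Squaring is additive, so the differences X, Y satisfy (l + 1) X = l Y and (l + 1) X² = l Y².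
    -- Squaring the first and inserting the second gives (l + 1)² X² = l (l + 1) X², that is (l + 1)
    -- X² = 0.
    parabola : ∀ {l x y x′ y′} → l ≢ 0# → l ≢ 1# → line x l y ≡ line x′ l y′ →
               line (x · x) l (y · y) ≡ line (x′ · x′) l (y′ · y′) → x ≡ x′ × y ≡ y′
    parabola {l} {x} {y} {x′} {y′} l≢0 l≢1 e e² = x+y≡0⇒x≡y X≡0 , x+y≡0⇒x≡y Y≡0
      where
      open ≡-Reasoning
      X Y : A
      X = x + x′
      Y = y + y′
      p : (l + 1#) · X ≡ l · Y
      p = line-injective e
      p² : (l + 1#) · (X · X) ≡ l · (Y · Y)
      p² = begin
        (l + 1#) · (X · X)                    ≡⟨ solve 3 (λ l x y → (l :+ con true) :* ((x :+ y) :* (x :+ y)) := (l :+ con true) :* (x :* x :+ y :* y)) refl l x x′ ⟩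
        (l + 1#) · ((x · x) + (x′ · x′))      ≡⟨ line-injective e² ⟩
        l · ((y · y) + (y′ · y′))             ≡⟨ solve 3 (λ l x y → l :* ((x :+ y) :* (x :+ y)) := l :* (x :* x :+ y :* y)) refl l y y′ ⟨
        l · (Y · Y)                           ∎
      square : (((l + 1#) · X) · X) ≡ 0#
      square = begin
        (((l + 1#) · X) · X)
          ≡⟨ solve 2 (λ l x → ((l :+ con true) :* x) :* x := ((l :+ con true) :* x) :* ((l :+ con true) :* x) :+ l :* ((l :+ con true) :* (x :* x))) refl l X ⟩
        (((l + 1#) · X) · ((l + 1#) · X)) + (l · ((l + 1#) · (X · X)))
          ≡⟨ cong₂ (λ u v → (u · u) + (l · v)) p p² ⟩
        ((l · Y) · (l · Y)) + (l · (l · (Y · Y)))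
          ≡⟨ solve 2 (λ l y → (l :* y) :* (l :* y) :+ l :* (l :* (y :* y)) := con false) refl l Y ⟩
        0# ∎
      l+1≢0 : l + 1# ≢ 0#
      l+1≢0 = l≢1 ∘ x+y≡0⇒x≡y
      X≡0 : X ≡ 0#
      X≡0 = zero-product (X ≟ᶠ 0#)
        where zero-product : Dec (X ≡ 0#) → X ≡ 0#
              zero-product (yes X≡0) = X≡0
              zero-product (no  X≢0) = contradiction square (·-nonzero (·-nonzero l+1≢0 X≢0) X≢0)
      Y≡0 : Y ≡ 0#
      Y≡0 = ·-cancelʳ l≢0 (begin
        Y · l               ≡⟨ *-comm Y l ⟩
        l · Y               ≡⟨ p ⟨
        (l + 1#) · X        ≡⟨ trans (cong ((l + 1#) ·_) X≡0) (zeroʳ _) ⟩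
        0#                  ≡⟨ zeroˡ l ⟨
        0# · l              ∎)
    separated′ : ∀ {l} → l ≢ 0# → l ≢ 1# → ∀ i j i′ j′ →
                 (∀ c → line (member′ i c) l (member′ j c) ≡ line (member′ i′ c) l (member′ j′ c)) → i ≡ i′ × j ≡ j′
    separated′ l≢0 l≢1 (i , x) (j , y) (i′ , x′) (j′ , y′) e =
      let i≡ , j≡ = separated l≢0 l≢1 i j i′ j′ (λ c → e (suc (suc c)))
          x≡ , y≡ = parabola l≢0 l≢1 (e zero) (e (suc zero))
      in cong₂ _,_ i≡ x≡ , cong₂ _,_ j≡ y≡

  ω≢0 : ω ≢ 0#
  ω≢0 ω≡0 = δ≢0 (trans (cong (λ w → (w · w) + w) ω≡0) (solve 0 (con false :* con false :+ con false := con false) refl))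

  ω≢1 : ω ≢ 1#
  ω≢1 ω≡1 = δ≢0 (trans (cong (λ w → (w · w) + w) ω≡1) (solve 0 (con true :* con true :+ con true := con false) refl))

  line-const : ∀ l x → line x l x ≡ x
  line-const l x = solve 2 (λ l x → x :+ l :* (x :+ :- x) := x) refl l x

  line-0 : ∀ x y → line x 0# y ≡ x
  line-0 x y = solve 2 (λ x y → x :+ con false :* (y :+ :- x) := x) refl x y

  line-1 : ∀ x y → line x 1# y ≡ y
  line-1 x y = solve 2 (λ x y → x :+ con true :* (y :+ :- x) := y) refl x y

  module Doubling {r} (G : Family r) where
    open Family G
    open AffineSpace F (suc r) hiding (Point)

    Point : Set
    Point = Fin (suc r) → A

    -- By counting: there are size² = q^r pairs (i , j).
    covered : ∀ {l} → l ≢ 0# → l ≢ 1# → ∀ (v : Fin r → A) → ∃₂ λ i j → ∀ c → line (member i c) l (member j c) ≡ v c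
    covered {l} l≢0 l≢1 v =
      let x , fx≡v = injective⇒surjective count f f-inj (funToFin v)
          i , j = remQuot size x
      in i , j , λ c → trans (sym (finToFun-funToFin (g (i , j)) c)) (trans (cong (λ y → finToFun y c) fx≡v) (finToFun-funToFin v c))
      where
      g : Fin size × Fin size → Fin r → A
      g (i , j) c = line (member i c) l (member j c)
      f : Fin (size ℕ.* size) → Fin (suc n ℕ.^ r)
      f x = funToFin (g (remQuot size x))
      f-inj : ∀ {x y} → f x ≡ f y → x ≡ y
      f-inj {x} {y} e = let i≡ , j≡ = separated l≢0 l≢1 _ _ _ _ (λ c →
                              trans (sym (finToFun-funToFin (g (remQuot size x)) c))
                              (trans (cong (λ z → finToFun z c) e) (finToFun-funToFin (g (remQuot size y)) c)))
                        in remQuot-injective size (cong₂ _,_ i≡ j≡)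
      count : suc n ℕ.^ r ≤ size ℕ.* size
      count = ℕₚ.≤-reflexive (trans (cong (ℕ._^ r) q≡ss) (trans (square-^ s r) (sym (cong₂ ℕ._*_ size≡ size≡))))

    -- Separation at a single scalar is enough; ω serves as a scalar that is certainly neither 0 nor
    -- 1.
    member-injective : ∀ {i j} → (∀ c → member i c ≡ member j c) → i ≡ j
    member-injective e = proj₁ (separated ω≢0 ω≢1 _ _ _ _ (λ c → cong (λ x → line x ω x) (e c)))

    level : Fin 2 → A
    level 0F = 0#
    level 1F = 1#

    point : Fin size × Fin 2 → Point
    point (i , e) zero    = level e
    point (i , e) (suc c) = member i c

    point-injective : ∀ {x y} → (∀ c → point x c ≡ point y c) → x ≡ y
    point-injective {i , e} {j , f} p = cong₂ _,_ (member-injective (p ∘ suc)) (level-injective e f (p zero))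
      where
      level-injective : ∀ e f → level e ≡ level f → e ≡ f
      level-injective 0F 0F _ = refl
      level-injective 0F 1F p = contradiction p 0≢1
      level-injective 1F 0F p = contradiction (sym p) 0≢1
      level-injective 1F 1F _ = refl

    cap : List Point
    cap = tabulate (λ i → point (remQuot {size} 2 i))

    point∈cap : ∀ x → point x ∈ cap
    point∈cap (i , e) = subst (λ x → point x ∈ cap) (remQuot-combine {size} i e) (∈-tabulate⁺ (combine i e))

    ∈cap⇒point : ∀ {a} → a ∈ cap → ∃ λ x → a ≡ point x
    ∈cap⇒point a∈ = let i , a≡ = ∈-tabulate⁻ a∈ in remQuot 2 i , a≡

    level≢ : ∀ {l} → l ≢ 0# → l ≢ 1# → ∀ e → l ≢ level e
    level≢ l≢0 l≢1 0F = l≢0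
    level≢ l≢0 l≢1 1F = l≢1

    -- For l ≠ 0, 1 the member of G under the third point is also the secant point of itself with
    -- itself, so separation makes all three members equal. The first two points then differ in
    -- level, and the point with parameter l between two different levels lies on neither.
    not-collinear : ∀ {x y z} → x ≢ y → x ≢ z → y ≢ z → ¬ Collinear (point x) (point y) (point z)
    not-collinear {x} {y} {z} x≢y x≢z y≢z (l , col) = cases (l ≟ᶠ 0#) (l ≟ᶠ 1#)
      where
      transversal : l ≢ 0# → l ≢ 1# → ∀ e f g → level g ≡ line (level e) l (level f) → e ≡ f
      transversal l≢0 l≢1 0F 0F g p = refl
      transversal l≢0 l≢1 1F 1F g p = refl
      transversal l≢0 l≢1 0F 1F g p = contradiction
        (trans (solve 1 (λ l → l := con false :+ l :* (con true :+ :- con false)) refl l) (sym p)) (level≢ l≢0 l≢1 g)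
      transversal l≢0 l≢1 1F 0F g p = contradiction
        (trans (solve 1 (λ l → l :+ con true := con true :+ l :* (con false :+ :- con true)) refl l) (sym p))
        (level≢ (l≢1 ∘ x+y≡0⇒x≡y) (λ e → l≢0 (+-cancelʳ (trans e (sym (+-identityˡ 1#))))) g)
      cases : Dec (l ≡ 0#) → Dec (l ≡ 1#) → ⊥
      cases (yes l≡0) _ = x≢z (point-injective (λ c → sym (trans (col c) (trans (cong (λ l → line _ l _) l≡0) (line-0 _ _)))))
      cases _ (yes l≡1) = y≢z (point-injective (λ c → sym (trans (col c) (trans (cong (λ l → line _ l _) l≡1) (line-1 _ _)))))
      cases (no l≢0) (no l≢1) = x≢y (cong₂ _,_ (trans i≡k (sym j≡k)) (transversal l≢0 l≢1 (proj₂ x) (proj₂ y) (proj₂ z) (col zero)))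
        where
        together = separated l≢0 l≢1 (proj₁ x) (proj₁ y) (proj₁ z) (proj₁ z) (λ c → trans (sym (col (suc c))) (sym (line-const l _)))
        i≡k = proj₁ together
        j≡k = proj₂ together

    isCap : IsCap cap
    isCap = tabulate⁺ (λ e → remQuot-injective {size} 2 (point-injective (λ c → cong (λ f → f c) e))) , triple
      where
      triple : ∀ {a b c} → a ∈ cap → b ∈ cap → c ∈ cap → a ≢ b → a ≢ c → b ≢ c → ¬ Collinear a b c
      triple a∈ b∈ c∈ = points (∈cap⇒point a∈) (∈cap⇒point b∈) (∈cap⇒point c∈)
        where
        points : ∀ {a b c} → (∃ λ x → a ≡ point x) → (∃ λ x → b ≡ point x) → (∃ λ x → c ≡ point x) →
                 a ≢ b → a ≢ c → b ≢ c → ¬ Collinear a b c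
        points (x , refl) (y , refl) (z , refl) a≢b a≢c b≢c =
          not-collinear (a≢b ∘ cong point) (a≢c ∘ cong point) (b≢c ∘ cong point)

    OnSecant : Point → Set
    OnSecant p = ∃₂ λ x y → x ≢ y × (∀ z → z ≡ x ⊎ z ≡ y → ¬ (∀ c → p c ≡ point z c)) × Collinear (point x) (point y) p

    Covered : Point → Set
    Covered p = (∃ λ x → ∀ c → p c ≡ point x c) ⊎ OnSecant p

    cover : ∀ p → Covered p
    cover p = cases (p zero ≟ᶠ 0#) (p zero ≟ᶠ 1#)
      where
      inLevel : ∀ e → p zero ≡ level e → Covered p
      -- Any scalar other than 0 and 1 would do here: the secant points with parameter ω already
      -- exhaust the level. The case i = j says that p belongs to the cap.
      inLevel e p₀ = let i , j , eq = covered ω≢0 ω≢1 (p ∘ suc) in split eq (i ≟ᶠ j)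
        where
        split : ∀ {i j} → (∀ c → line (member i c) ω (member j c) ≡ p (suc c)) → Dec (i ≡ j) → Covered p
        split {i} eq (yes refl) = inj₁ ((i , e) , λ { zero → p₀ ; (suc c) → trans (sym (eq c)) (line-const ω _) })
        split {i} {j} eq (no i≢j) = inj₂ ((i , e) , (j , e) , i≢j ∘ cong proj₁ , off , ω ,
          λ { zero → trans p₀ (sym (line-const ω _)) ; (suc c) → sym (eq c) })
          where
          off : ∀ z → z ≡ (i , e) ⊎ z ≡ (j , e) → ¬ (∀ c → p c ≡ point z c)
          off z z∈ p≗z = i≢j (both (separated ω≢0 ω≢1 i j (proj₁ z) (proj₁ z)
            (λ c → trans (eq c) (trans (p≗z (suc c)) (sym (line-const ω _))))))
            where both : ∀ {k} → i ≡ k × j ≡ k → i ≡ j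
                  both (i≡k , j≡k) = trans i≡k (sym j≡k)
      cases : Dec (p zero ≡ 0#) → Dec (p zero ≡ 1#) → Covered p
      cases (yes p₀≡0) _ = inLevel 0F p₀≡0
      cases _ (yes p₀≡1) = inLevel 1F p₀≡1
      -- On a secant from level 0 to level 1 the parameter is the height, so l is forced to be
      -- `p zero`.
      cases (no p₀≢0) (no p₀≢1) = let i , j , eq = covered p₀≢0 p₀≢1 (p ∘ suc) in
        inj₂ ((i , 0F) , (j , 1F) , (λ ()) , (λ z _ p≗z → level≢ p₀≢0 p₀≢1 (proj₂ z) (p≗z zero)) , p zero ,
          λ { zero → solve 1 (λ l → l := con false :+ l :* (con true :+ :- con false)) refl (p zero) ; (suc c) → sym (eq c) })

    opposite : Fin size × Fin 2 → Fin size × Fin 2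
    opposite (i , 0F) = i , 1F
    opposite (i , 1F) = i , 0F

    opposite≢ : ∀ x → opposite x ≢ x
    opposite≢ (i , 0F) ()
    opposite≢ (i , 1F) ()

    -- Without function extensionality a point p of a larger cap may agree with a point of
    -- cap without being equal to it; such a p is collinear with that point and any third one.
    isComplete : IsComplete cap
    isComplete = isCap , λ D (unique , noThree) cap⊆D {p} p∈D → cases D unique noThree cap⊆D p∈D (cover p)
      where
      cases : ∀ D → Unique D → (∀ {a b c} → a ∈ D → b ∈ D → c ∈ D → a ≢ b → a ≢ c → b ≢ c → ¬ Collinear a b c) →
              (∀ {x} → x ∈ cap → x ∈ D) → ∀ {p} → p ∈ D → Covered p → p ∈ cap
      cases D unique noThree cap⊆D {p} p∈D (inj₁ (x , p≗x)) = agree (∈-decidable-≡ unique p∈D x∈D)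
        where
        x∈D : point x ∈ D
        x∈D = cap⊆D (point∈cap x)
        agree : p ≡ point x ⊎ p ≢ point x → p ∈ cap
        agree (inj₁ p≡x) = subst (_∈ cap) (sym p≡x) (point∈cap x)
        agree (inj₂ p≢x) = ⊥-elim (noThree p∈D (cap⊆D (point∈cap (opposite x))) x∈D
          (λ p≡o → opposite≢ x (point-injective (λ c → trans (sym (cong (λ f → f c) p≡o)) (p≗x c))))
          p≢x
          (λ o≡x → opposite≢ x (point-injective (λ c → cong (λ f → f c) o≡x)))
          (0# , λ c → sym (trans (line-0 (p c) (point (opposite x) c)) (p≗x c))))
      cases D unique noThree cap⊆D {p} p∈D (inj₂ (x , y , x≢y , off , col)) =
        ⊥-elim (noThree (cap⊆D (point∈cap x)) (cap⊆D (point∈cap y)) p∈D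
          (λ e → x≢y (point-injective (λ c → cong (λ f → f c) e)))
          (λ e → off x (inj₁ refl) (λ c → sym (cong (λ f → f c) e)))
          (λ e → off y (inj₂ refl) (λ c → sym (cong (λ f → f c) e))) col)

    length-cap : length cap ≡ 2 ℕ.* s ℕ.^ r
    length-cap = trans (length-tabulate (λ i → point (remQuot {size} 2 i))) (trans (ℕₚ.*-comm size 2) (cong (2 ℕ.*_) size≡))

  family : Twist → ∀ m → Family (3 ℕ.+ m ℕ.* 2)
  family T zero    = FromTwist.family₃ T
  family T (suc m) = addParabola (family T m)

-- Classes of field elements modulo seventh powers.

module SeventhPowers {A : Set} {_+_ _·_ : Op₂ A} { -_ : Op₁ A} {0# 1# : A}
    (isCR : IsCommutativeRing _≡_ _+_ _·_ -_ 0# 1#) (1+1≡0 : (1# + 1#) ≡ 0#) (0≢1 : 0# ≢ 1#)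
    (unit : ∀ x → x ≢ 0# → ∃ λ y → (x · y) ≡ 1#) where

  open Char2 isCR 1+1≡0
  open Units isCR 0≢1 unit

  -- Not a quotient of seventh powers, written without division. The case v = 0 also excludes m = 0.
  SeventhFree : A → Set
  SeventhFree m = ∀ u v → u ≢ 0# → (m · (u ^ 7)) ≢ (v ^ 7)

  free⇒≢0 : ∀ {m} → SeventhFree m → m ≢ 0#
  free⇒≢0 free refl = free 1# 0# (0≢1 ∘ sym) (trans (zeroˡ _) (sym (zeroˡ _)))

  -- 4 inverts 2 modulo 7: m · m⁷ = (m²)⁴, so m would inherit being a quotient of seventh powers
  -- from m².
  free-² : ∀ {m} → SeventhFree m → SeventhFree (m ^ 2)
  free-² {m} free u v u≢0 e = free (m · (u ^ 4)) (v ^ 4) (·-nonzero (free⇒≢0 free) (^-nonzero 4 u≢0)) (begin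
    m · ((m · (u ^ 4)) ^ 7)     ≡⟨ solve 2 (λ m u → m :* (m :* u :^ 4) :^ 7 := (m :^ 2 :* u :^ 7) :^ 4) refl m u ⟩
    ((m ^ 2) · (u ^ 7)) ^ 4     ≡⟨ cong (_^ 4) e ⟩
    (v ^ 7) ^ 4                 ≡⟨ ^-comm v 7 4 ⟩
    (v ^ 4) ^ 7                 ∎)
    where open ≡-Reasoning

  -- 5 inverts 3 modulo 7: m · (m²)⁷ = (m³)⁵.
  free-³ : ∀ {m} → SeventhFree m → SeventhFree (m ^ 3)
  free-³ {m} free u v u≢0 e = free ((m ^ 2) · (u ^ 5)) (v ^ 5) (·-nonzero (^-nonzero 2 (free⇒≢0 free)) (^-nonzero 5 u≢0)) (begin
    m · (((m ^ 2) · (u ^ 5)) ^ 7)     ≡⟨ solve 2 (λ m u → m :* (m :^ 2 :* u :^ 5) :^ 7 := (m :^ 3 :* u :^ 7) :^ 5) refl m u ⟩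
    ((m ^ 3) · (u ^ 7)) ^ 5           ≡⟨ cong (_^ 5) e ⟩
    (v ^ 7) ^ 5                       ≡⟨ ^-comm v 7 5 ⟩
    (v ^ 5) ^ 7                       ∎)
    where open ≡-Reasoning

  free-·⁷ : ∀ {m w} → w ≢ 0# → SeventhFree m → SeventhFree (m · (w ^ 7))
  free-·⁷ {m} {w} w≢0 free u v u≢0 e = free (w · u) v (·-nonzero w≢0 u≢0)
    (trans (solve 3 (λ m w u → m :* (w :* u) :^ 7 := (m :* w :^ 7) :* u :^ 7) refl m w u) e)

  ^-mod7 : ∀ x r M → x ^ (r ℕ.+ M ℕ.* 7) ≡ ((x ^ r) · ((x ^ M) ^ 7))
  ^-mod7 x r M = trans (^-homo-* x r (M ℕ.* 7)) (cong ((x ^ r) ·_) (sym (^-assocʳ x M 7)))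

  -- Such an exponent acts on classes as squaring. Norms x · x^e with e ≡ 1 modulo 7 are of this
  -- form, and they are how nonresidues are brought into a fixed field.
  free-^[2+7M] : ∀ {m} M → SeventhFree m → SeventhFree (m ^ (2 ℕ.+ M ℕ.* 7))
  free-^[2+7M] {m} M free = subst SeventhFree (sym (^-mod7 m 2 M)) (free-·⁷ (^-nonzero M (free⇒≢0 free)) (free-² free))

  not-seventh⇒free : ∀ {m} → (∀ w → w ^ 7 ≢ m) → SeventhFree m
  not-seventh⇒free {m} not-seventh u v u≢0 e = let w , uw≡1 = unit u u≢0 in not-seventh (v · w) (begin
    (v · w) ^ 7                     ≡⟨ ^-distrib-* v w 7 ⟩
    (v ^ 7) · (w ^ 7)               ≡⟨ cong (_· (w ^ 7)) e ⟨
    (m · (u ^ 7)) · (w ^ 7)         ≡⟨ solve 3 (λ m u w → (m :* u :^ 7) :* w :^ 7 := m :* (u :* w) :^ 7) refl m u w ⟩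
    m · ((u · w) ^ 7)               ≡⟨ cong (λ t → m · t) (trans (cong (_^ 7) uw≡1) (1^ 7)) ⟩
    m · 1#                          ≡⟨ *-identityʳ m ⟩
    m                               ∎)
    where open ≡-Reasoning

  x³≡x+1⇒x⁷≡1 : ∀ {x} → x ^ 3 ≡ (x + 1#) → x ^ 7 ≡ 1#
  x³≡x+1⇒x⁷≡1 {x} e = begin
    x ^ 7                       ≡⟨ solve 1 (λ x → x :^ 7 := x :* (x :^ 3) :^ 2) refl x ⟩
    x · ((x ^ 3) ^ 2)           ≡⟨ cong (λ t → x · (t ^ 2)) e ⟩
    x · ((x + 1#) ^ 2)          ≡⟨ solve 1 (λ x → x :* (x :+ con true) :^ 2 := x :^ 3 :+ x) refl x ⟩
    (x ^ 3) + x                 ≡⟨ cong (_+ x) e ⟩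
    (x + 1#) + x                ≡⟨ solve 1 (λ x → (x :+ con true) :+ x := con true) refl x ⟩
    1#                          ∎
    where open ≡-Reasoning

8^j≡1+7M : ∀ j → ∃ λ M → 2 ℕ.^ (j ℕ.* 3) ≡ 1 ℕ.+ M ℕ.* 7
8^j≡1+7M zero = 0 , refl
8^j≡1+7M (suc j) with M , eq ← 8^j≡1+7M j = 1 ℕ.+ M ℕ.* 8 , trans (cong (λ t → 2 ℕ.* (2 ℕ.* (2 ℕ.* t))) eq) (lemma M)
  where
  lemma : ∀ M → 2 ℕ.* (2 ℕ.* (2 ℕ.* (1 ℕ.+ M ℕ.* 7))) ≡ 1 ℕ.+ (1 ℕ.+ M ℕ.* 8) ℕ.* 7
  lemma = solve-∀

-- The case 3 | k, where s ≡ 1 modulo 7: the cyclic semilinear map.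

module CyclicTwist {n} (F : FiniteField (suc n)) (k : ℕ) (0<k : 0 < k) (q≡ss : suc n ≡ 2 ℕ.^ k ℕ.* 2 ℕ.^ k)
                   (M : ℕ) (s≡1+7M : 2 ℕ.^ k ≡ 1 ℕ.+ M ℕ.* 7) where
  open QuadraticExtension F k 0<k q≡ss
  open Families F k 0<k q≡ss
  open SeventhPowers isCommutativeRing 1+1≡0 0≢1 unit

  private
    -- This is (q - 1)/7, from q - 1 = (s + 1)(s - 1) with s = 1 + 7 M.
    e : ℕ
    e = (M ℕ.* 7 ℕ.+ 2) ℕ.* M

    n≡7e : n ≡ e ℕ.* 7
    n≡7e = ℕₚ.suc-injective (trans q≡ss (trans (cong (λ t → t ℕ.* t) s≡1+7M) (lemma M)))
      where
      lemma : ∀ M → (1 ℕ.+ M ℕ.* 7) ℕ.* (1 ℕ.+ M ℕ.* 7) ≡ suc (((M ℕ.* 7 ℕ.+ 2) ℕ.* M) ℕ.* 7)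
      lemma = solve-∀

    0<e : 0 < e
    0<e = positive M (trans (sym (proj₂ s≡2+)) s≡1+7M)
      where
      positive : ∀ M {m} → suc (suc m) ≡ 1 ℕ.+ M ℕ.* 7 → 0 < (M ℕ.* 7 ℕ.+ 2) ℕ.* M
      positive (suc M) _ = s≤s z≤n

    e<n : e < n
    e<n = subst (e <_) (sym n≡7e) (ℕₚ.m<m*n e 7 {{ℕ.>-nonZero 0<e}} (s≤s (s≤s z≤n)))

    seed : ∃ λ x → x ≢ 0# × x ^ e ≢ 1#
    seed = ∃x^e≢1 0<e e<n

  -- Euler's criterion: x^((q-1)/7) ≠ 1 shows that x is not a quotient of seventh powers. Its norm
  -- x^(1+s) to F₀ is fixed by `bar` and keeps this property, as 1 + s = 2 + 7 M.
  nonresidue : ∃ λ c → Fixed c × SeventhFree c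
  nonresidue = let x , x≢0 , x^e≢1 = seed in
    x ^ (2 ℕ.+ M ℕ.* 7) , fixed x , free-^[2+7M] M (free x≢0 x^e≢1)
    where
    open ≡-Reasoning
    norm : ∀ x → x · bar x ≡ x ^ (2 ℕ.+ M ℕ.* 7)
    norm x = cong (λ t → x · (x ^ t)) s≡1+7M
    fixed : ∀ x → Fixed (x ^ (2 ℕ.+ M ℕ.* 7))
    fixed x = subst Fixed (norm x) (trans (bar-· x (bar x)) (trans (cong (bar x ·_) (bar-bar x)) (*-comm (bar x) x)))
    u^7e≡1 : ∀ {u} → u ≢ 0# → (u ^ 7) ^ e ≡ 1#
    u^7e≡1 {u} u≢0 = trans (^-comm u 7 e) (trans (^-assocʳ u e 7) (trans (cong (u ^_) (sym n≡7e)) (x^[q-1]≡1 u≢0)))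
    free : ∀ {x} → x ≢ 0# → x ^ e ≢ 1# → SeventhFree x
    free {x} x≢0 x^e≢1 u v u≢0 p = x^e≢1 (begin
      x ^ e                       ≡⟨ *-identityʳ _ ⟨
      (x ^ e) · 1#                ≡⟨ cong ((x ^ e) ·_) (u^7e≡1 u≢0) ⟨
      (x ^ e) · ((u ^ 7) ^ e)     ≡⟨ ^-distrib-* x (u ^ 7) e ⟨
      (x · (u ^ 7)) ^ e           ≡⟨ cong (_^ e) p ⟩
      (v ^ 7) ^ e                 ≡⟨ u^7e≡1 v≢0 ⟩
      1#                          ∎)
      where
      v≢0 : v ≢ 0#
      v≢0 v≡0 = ·-nonzero x≢0 (^-nonzero 7 u≢0) (trans p (trans (cong (_^ 7) v≡0) (zeroˡ _)))

  -- The relations read Y₁² = b + a/Y₂ and cyclically. Adding two of them removes b: d₁² Y₂ Y₃ = a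
  -- d₂ for d₁ = Y₁ + Y₂, d₂ = Y₂ + Y₃, and cyclically. Dividing removes a and expresses Y₂/Y₁ and
  -- Y₃/Y₁ through the d's, whereupon the product becomes (Y₁ d₂²/d₁²)⁷. If d₁ = 0, then d₂ = 0 as
  -- well and the three Y's agree.
  product-seventh : ∀ {a b Y₁ Y₂ Y₃} → a ≢ 0# → Y₁ ≢ 0# → Y₂ ≢ 0# → Y₃ ≢ 0# →
    (Y₃ ^ 2) · Y₁ ≡ (b · Y₁) + a → (Y₂ ^ 2) · Y₃ ≡ (b · Y₃) + a → (Y₁ ^ 2) · Y₂ ≡ (b · Y₂) + a →
    ∃₂ λ u v → u ≢ 0# × (Y₁ · ((Y₂ ^ 4) · (Y₃ ^ 2))) · (u ^ 7) ≡ v ^ 7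
  product-seventh {a} {b} {Y₁} {Y₂} {Y₃} a≢0 Y₁≢0 Y₂≢0 Y₃≢0 E₁ E₃ E₂ = cases (d₁ ≟ᶠ 0#)
    where
    open ≡-Reasoning
    d₁ d₂ d₃ : A
    d₁ = Y₁ + Y₂
    d₂ = Y₂ + Y₃
    d₃ = Y₃ + Y₁
    difference : ∀ X Y Z → (Y ^ 2) · Z ≡ (b · Z) + a → (X ^ 2) · Y ≡ (b · Y) + a →
                 ((X + Y) ^ 2) · (Y · Z) ≡ a · (Y + Z)
    difference X Y Z p q = begin
      ((X + Y) ^ 2) · (Y · Z)                       ≡⟨ solve 3 (λ X Y Z → (X :+ Y) :^ 2 :* (Y :* Z) := Z :* (X :^ 2 :* Y) :+ Y :* (Y :^ 2 :* Z)) refl X Y Z ⟩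
      (Z · ((X ^ 2) · Y)) + (Y · ((Y ^ 2) · Z))     ≡⟨ cong₂ (λ u v → (Z · u) + (Y · v)) q p ⟩
      (Z · ((b · Y) + a)) + (Y · ((b · Z) + a))     ≡⟨ solve 4 (λ Y Z a b → Z :* (b :* Y :+ a) :+ Y :* (b :* Z :+ a) := a :* (Y :+ Z)) refl Y Z a b ⟩
      a · (Y + Z)                                   ∎
    D₁ : (d₁ ^ 2) · (Y₂ · Y₃) ≡ a · d₂
    D₁ = difference Y₁ Y₂ Y₃ E₃ E₂
    D₂ : (d₂ ^ 2) · (Y₃ · Y₁) ≡ a · d₃
    D₂ = difference Y₂ Y₃ Y₁ E₁ E₃
    D₃ : (d₃ ^ 2) · (Y₁ · Y₂) ≡ a · d₁
    D₃ = difference Y₃ Y₁ Y₂ E₂ E₁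
    next≢0 : ∀ {x y z} → x ≢ 0# → y ≢ 0# → (x ^ 2) · y ≡ a · z → z ≢ 0#
    next≢0 x≢0 y≢0 e z≡0 = ·-nonzero (^-nonzero 2 x≢0) y≢0 (trans e (trans (cong (a ·_) z≡0) (zeroʳ a)))
    cases : Dec (d₁ ≡ 0#) → _
    cases (yes d₁≡0) = 1# , Y₁ , 0≢1 ∘ sym , (begin
      (Y₁ · ((Y₂ ^ 4) · (Y₃ ^ 2))) · (1# ^ 7)   ≡⟨ cong₂ (λ y z → (Y₁ · ((y ^ 4) · (z ^ 2))) · (1# ^ 7)) Y₂≡Y₁ Y₃≡Y₁ ⟩
      (Y₁ · ((Y₁ ^ 4) · (Y₁ ^ 2))) · (1# ^ 7)   ≡⟨ solve 1 (λ y → (y :* (y :^ 4 :* y :^ 2)) :* con true :^ 7 := y :^ 7) refl Y₁ ⟩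
      Y₁ ^ 7                                    ∎)
      where
      d₂≡0 : d₂ ≡ 0#
      d₂≡0 = ·-cancelʳ a≢0 (begin
        d₂ · a                      ≡⟨ *-comm d₂ a ⟩
        a · d₂                      ≡⟨ D₁ ⟨
        (d₁ ^ 2) · (Y₂ · Y₃)        ≡⟨ cong (λ d → (d ^ 2) · (Y₂ · Y₃)) d₁≡0 ⟩
        (0# ^ 2) · (Y₂ · Y₃)        ≡⟨ solve 2 (λ a y → con false :^ 2 :* y := con false :* a) refl a (Y₂ · Y₃) ⟩
        0# · a                      ∎)
      Y₂≡Y₁ : Y₂ ≡ Y₁
      Y₂≡Y₁ = sym (x+y≡0⇒x≡y d₁≡0)
      Y₃≡Y₁ : Y₃ ≡ Y₁
      Y₃≡Y₁ = trans (sym (x+y≡0⇒x≡y d₂≡0)) Y₂≡Y₁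
    cases (no d₁≢0) = d₁ ^ 2 , Y₁ · (d₂ ^ 2) , ^-nonzero 2 d₁≢0 , ·-cancelʳ (^-nonzero 4 d₃≢0) (begin
      ((Y₁ · ((Y₂ ^ 4) · (Y₃ ^ 2))) · ((d₁ ^ 2) ^ 7)) · (d₃ ^ 4)
        ≡⟨ solve 5 (λ x y z d f → ((x :* (y :^ 4 :* z :^ 2)) :* (d :^ 2) :^ 7) :* f :^ 4 := x :* ((y :* (d :^ 2 :* f)) :^ 4 :* (z :* d :^ 3) :^ 2)) refl Y₁ Y₂ Y₃ d₁ d₃ ⟩
      Y₁ · (((Y₂ · ((d₁ ^ 2) · d₃)) ^ 4) · ((Y₃ · (d₁ ^ 3)) ^ 2))
        ≡⟨ cong₂ (λ u v → Y₁ · ((u ^ 4) · (v ^ 2))) Y₂-ratio Y₃-ratio ⟩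
      Y₁ · (((Y₁ · (d₂ ^ 3)) ^ 4) · ((Y₁ · (d₂ · (d₃ ^ 2))) ^ 2))
        ≡⟨ solve 3 (λ x d f → x :* ((x :* d :^ 3) :^ 4 :* (x :* (d :* f :^ 2)) :^ 2) := (x :* d :^ 2) :^ 7 :* f :^ 4) refl Y₁ d₂ d₃ ⟩
      ((Y₁ · (d₂ ^ 2)) ^ 7) · (d₃ ^ 4) ∎)
      where
      d₂≢0 : d₂ ≢ 0#
      d₂≢0 = next≢0 d₁≢0 (·-nonzero Y₂≢0 Y₃≢0) D₁
      d₃≢0 : d₃ ≢ 0#
      d₃≢0 = next≢0 d₂≢0 (·-nonzero Y₃≢0 Y₁≢0) D₂
      Y₂-ratio : Y₂ · ((d₁ ^ 2) · d₃) ≡ Y₁ · (d₂ ^ 3)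
      Y₂-ratio = ·-cancelʳ (·-nonzero a≢0 Y₃≢0) (begin
        (Y₂ · ((d₁ ^ 2) · d₃)) · (a · Y₃)
          ≡⟨ solve 5 (λ y z d f a → (y :* (d :^ 2 :* f)) :* (a :* z) := (d :^ 2 :* (y :* z)) :* (a :* f)) refl Y₂ Y₃ d₁ d₃ a ⟩
        ((d₁ ^ 2) · (Y₂ · Y₃)) · (a · d₃)
          ≡⟨ cong₂ _·_ D₁ (sym D₂) ⟩
        (a · d₂) · ((d₂ ^ 2) · (Y₃ · Y₁))
          ≡⟨ solve 4 (λ x z d a → (a :* d) :* (d :^ 2 :* (z :* x)) := (x :* d :^ 3) :* (a :* z)) refl Y₁ Y₃ d₂ a ⟩
        (Y₁ · (d₂ ^ 3)) · (a · Y₃) ∎)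
      Y₃-ratio : Y₃ · (d₁ ^ 3) ≡ Y₁ · (d₂ · (d₃ ^ 2))
      Y₃-ratio = ·-cancelʳ (·-nonzero a≢0 Y₂≢0) (begin
        (Y₃ · (d₁ ^ 3)) · (a · Y₂)
          ≡⟨ solve 4 (λ y z d a → (z :* d :^ 3) :* (a :* y) := (d :^ 2 :* (y :* z)) :* (a :* d)) refl Y₂ Y₃ d₁ a ⟩
        ((d₁ ^ 2) · (Y₂ · Y₃)) · (a · d₁)
          ≡⟨ cong₂ _·_ D₁ (sym D₃) ⟩
        (a · d₂) · ((d₃ ^ 2) · (Y₁ · Y₂))
          ≡⟨ solve 5 (λ x y d f a → (a :* d) :* (f :^ 2 :* (x :* y)) := (x :* (d :* f :^ 2)) :* (a :* y)) refl Y₁ Y₂ d₂ d₃ a ⟩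
        (Y₁ · (d₂ · (d₃ ^ 2))) · (a · Y₂) ∎)

  module _ {c : A} (free : SeventhFree c) where
    private
      c≢0 : c ≢ 0#
      c≢0 = free⇒≢0 free

    -- The hypotheses are the coordinates of S² v = b S v + a v. If no coordinate of v vanishes, let
    -- Y₁, Y₂, Y₃ be the quotients of the coordinates of S v by those of v: then (S² v)₁/(S v)₁ =
    -- Y₃² and cyclically, which gives the relations of `product-seventh`. The weights 1, 4, 2
    -- cancel y and z, leaving Y₁ Y₂⁴ Y₃² = c x⁷. If exactly one coordinate vanishes, the equations
    -- become monomial and make c, c² or c³ a quotient of seventh powers.
    cyclic-irreducible : ∀ {a b x y z} → a ≢ 0# →
      c · ((y ^ 2) ^ 2) ≡ (b · (c · (z ^ 2))) + (a · x) →
      (c · (z ^ 2)) ^ 2 ≡ (b · (x ^ 2)) + (a · y) →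
      (x ^ 2) ^ 2 ≡ (b · (y ^ 2)) + (a · z) → (x , y , z) ≡ 0V
    cyclic-irreducible {a} {b} {x} {y} {z} a≢0 E₁ E₂ E₃ = cases (x ≟ᶠ 0#) (y ≟ᶠ 0#) (z ≟ᶠ 0#)
      where
      open ≡-Reasoning
      ^-zero : ∀ {x} m → x ^ m ≡ 0# → x ≡ 0#
      ^-zero {x} m e = [ (λ p → p) , (λ x≢0 → contradiction e (^-nonzero m x≢0)) ] (dec (x ≟ᶠ 0#))
        where dec : Dec (x ≡ 0#) → x ≡ 0# ⊎ x ≢ 0#
              dec (yes p) = inj₁ p
              dec (no  p) = inj₂ p
      scaled-zero : ∀ {u v} → u ≢ 0# → u · v ≡ 0# → v ≡ 0#
      scaled-zero {u} {v} u≢0 e = ·-cancelʳ u≢0 (trans (*-comm v u) (trans e (sym (zeroˡ u))))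

      x=y=0 : x ≡ 0# → y ≡ 0# → z ≡ 0#
      x=y=0 refl refl = ^-zero 2 (scaled-zero c≢0 (^-zero 2 (trans E₂ (solve 2 (λ a b → b :* con false :^ 2 :+ a :* con false := con false) refl a b))))

      x=0 : x ≡ 0# → y ≢ 0# → ⊥
      x=0 refl y≢0 = free-² free z y z≢0 (begin
        (c ^ 2) · (z ^ 7)                   ≡⟨ solve 2 (λ c z → c :^ 2 :* z :^ 7 := (c :* z :^ 2) :^ 2 :* z :^ 3) refl c z ⟩
        ((c · (z ^ 2)) ^ 2) · (z ^ 3)       ≡⟨ cong (_· (z ^ 3)) P₂ ⟩
        (a · y) · (z ^ 3)                   ≡⟨ solve 3 (λ a y z → (a :* y) :* z :^ 3 := (a :* z) :* (y :* z :^ 2)) refl a y z ⟩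
        (a · z) · (y · (z ^ 2))             ≡⟨ cong (_· (y · (z ^ 2))) P₃ ⟩
        (b · (y ^ 2)) · (y · (z ^ 2))       ≡⟨ solve 3 (λ b y z → (b :* y :^ 2) :* (y :* z :^ 2) := (b :* z :^ 2) :* y :^ 3) refl b y z ⟩
        (b · (z ^ 2)) · (y ^ 3)             ≡⟨ cong (_· (y ^ 3)) P₁ ⟩
        ((y ^ 2) ^ 2) · (y ^ 3)             ≡⟨ solve 1 (λ y → (y :^ 2) :^ 2 :* y :^ 3 := y :^ 7) refl y ⟩
        y ^ 7                               ∎)
        where
        P₁ : b · (z ^ 2) ≡ (y ^ 2) ^ 2
        P₁ = ·-cancelʳ c≢0 (begin
          (b · (z ^ 2)) · c                       ≡⟨ solve 4 (λ a b c z → (b :* z :^ 2) :* c := b :* (c :* z :^ 2) :+ a :* con false) refl a b c z ⟩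
          (b · (c · (z ^ 2))) + (a · 0#)          ≡⟨ E₁ ⟨
          c · ((y ^ 2) ^ 2)                       ≡⟨ *-comm c _ ⟩
          ((y ^ 2) ^ 2) · c                       ∎)
        P₂ : (c · (z ^ 2)) ^ 2 ≡ a · y
        P₂ = trans E₂ (solve 3 (λ a b y → b :* con false :^ 2 :+ a :* y := a :* y) refl a b y)
        P₃ : a · z ≡ b · (y ^ 2)
        P₃ = sym (x+y≡0⇒x≡y (trans (sym E₃) (solve 0 ((con false :^ 2) :^ 2 := con false) refl)))
        z≢0 : z ≢ 0#
        z≢0 z≡0 = ·-nonzero a≢0 y≢0 (trans (sym P₂) (trans (cong (λ z → (c · (z ^ 2)) ^ 2) z≡0) (solve 1 (λ c → (c :* con false :^ 2) :^ 2 := con false) refl c)))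

      y=0 : y ≡ 0# → x ≢ 0# → ⊥
      y=0 refl x≢0 = free-³ free z x z≢0 (begin
        (c ^ 3) · (z ^ 7)                         ≡⟨ solve 2 (λ c z → c :^ 3 :* z :^ 7 := (c :* z :^ 2) :^ 2 :* (c :* z :^ 3)) refl c z ⟩
        ((c · (z ^ 2)) ^ 2) · (c · (z ^ 3))       ≡⟨ cong (_· (c · (z ^ 3))) P₂ ⟩
        (b · (x ^ 2)) · (c · (z ^ 3))             ≡⟨ solve 4 (λ b c x z → (b :* x :^ 2) :* (c :* z :^ 3) := (b :* (c :* z :^ 2)) :* (x :^ 2 :* z)) refl b c x z ⟩
        (b · (c · (z ^ 2))) · ((x ^ 2) · z)       ≡⟨ cong (_· ((x ^ 2) · z)) P₁ ⟩
        (a · x) · ((x ^ 2) · z)                   ≡⟨ solve 3 (λ a x z → (a :* x) :* (x :^ 2 :* z) := (a :* z) :* x :^ 3) refl a x z ⟩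
        (a · z) · (x ^ 3)                         ≡⟨ cong (_· (x ^ 3)) P₃ ⟨
        ((x ^ 2) ^ 2) · (x ^ 3)                   ≡⟨ solve 1 (λ x → (x :^ 2) :^ 2 :* x :^ 3 := x :^ 7) refl x ⟩
        x ^ 7                                     ∎)
        where
        P₁ : b · (c · (z ^ 2)) ≡ a · x
        P₁ = x+y≡0⇒x≡y (trans (sym E₁) (solve 1 (λ c → c :* (con false :^ 2) :^ 2 := con false) refl c))
        P₂ : (c · (z ^ 2)) ^ 2 ≡ b · (x ^ 2)
        P₂ = trans E₂ (solve 3 (λ a b x → b :* x :^ 2 :+ a :* con false := b :* x :^ 2) refl a b x)
        P₃ : (x ^ 2) ^ 2 ≡ a · z
        P₃ = trans E₃ (solve 3 (λ a b z → b :* con false :^ 2 :+ a :* z := a :* z) refl a b z)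
        z≢0 : z ≢ 0#
        z≢0 z≡0 = ^-nonzero 2 (^-nonzero 2 x≢0) (trans P₃ (trans (cong (a ·_) z≡0) (zeroʳ a)))

      z=0 : z ≡ 0# → x ≢ 0# → y ≢ 0# → ⊥
      z=0 refl x≢0 y≢0 = free y x y≢0 (begin
        c · (y ^ 7)                             ≡⟨ solve 2 (λ c y → c :* y :^ 7 := (c :* (y :^ 2) :^ 2) :* y :^ 3) refl c y ⟩
        (c · ((y ^ 2) ^ 2)) · (y ^ 3)           ≡⟨ cong (_· (y ^ 3)) P₁ ⟩
        (a · x) · (y ^ 3)                       ≡⟨ solve 3 (λ a x y → (a :* x) :* y :^ 3 := (a :* y) :* (x :* y :^ 2)) refl a x y ⟩
        (a · y) · (x · (y ^ 2))                 ≡⟨ cong (_· (x · (y ^ 2))) P₂ ⟨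
        (b · (x ^ 2)) · (x · (y ^ 2))           ≡⟨ solve 3 (λ b x y → (b :* x :^ 2) :* (x :* y :^ 2) := (b :* y :^ 2) :* x :^ 3) refl b x y ⟩
        (b · (y ^ 2)) · (x ^ 3)                 ≡⟨ cong (_· (x ^ 3)) P₃ ⟨
        ((x ^ 2) ^ 2) · (x ^ 3)                 ≡⟨ solve 1 (λ x → (x :^ 2) :^ 2 :* x :^ 3 := x :^ 7) refl x ⟩
        x ^ 7                                   ∎)
        where
        P₁ : c · ((y ^ 2) ^ 2) ≡ a · x
        P₁ = trans E₁ (solve 4 (λ a b c x → b :* (c :* con false :^ 2) :+ a :* x := a :* x) refl a b c x)
        P₂ : b · (x ^ 2) ≡ a · y
        P₂ = x+y≡0⇒x≡y (trans (sym E₂) (solve 1 (λ c → (c :* con false :^ 2) :^ 2 := con false) refl c))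
        P₃ : (x ^ 2) ^ 2 ≡ b · (y ^ 2)
        P₃ = trans E₃ (solve 3 (λ a b y → b :* y :^ 2 :+ a :* con false := b :* y :^ 2) refl a b y)

      generic : x ≢ 0# → y ≢ 0# → z ≢ 0# → ⊥
      generic x≢0 y≢0 z≢0 =
        let u , v , u≢0 , eq = product-seventh {a} {b} a≢0 Y₁≢0 Y₂≢0 Y₃≢0 F₁ F₃ F₂
        in free (x · u) v (·-nonzero x≢0 u≢0) (begin
          c · ((x · u) ^ 7)                               ≡⟨ solve 3 (λ c x u → c :* (x :* u) :^ 7 := (c :* x :^ 7) :* u :^ 7) refl c x u ⟩
          (c · (x ^ 7)) · (u ^ 7)                         ≡⟨ cong (_· (u ^ 7)) product ⟨
          (Y₁ · ((Y₂ ^ 4) · (Y₃ ^ 2))) · (u ^ 7)          ≡⟨ eq ⟩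
          v ^ 7                                           ∎)
        where
        ratio : ∀ u {v} → v ≢ 0# → A
        ratio u {v} v≢0 = u · proj₁ (unit v v≢0)
        ratio-· : ∀ u {v} (v≢0 : v ≢ 0#) → ratio u v≢0 · v ≡ u
        ratio-· u {v} v≢0 = trans (*-assoc u _ v) (trans (cong (u ·_) (trans (*-comm _ v) (proj₂ (unit v v≢0)))) (*-identityʳ u))
        ratio≢0 : ∀ {u v} (v≢0 : v ≢ 0#) → u ≢ 0# → ratio u v≢0 ≢ 0#
        ratio≢0 {u} {v} v≢0 u≢0 r≡0 = u≢0 (trans (sym (ratio-· u v≢0)) (trans (cong (_· v) r≡0) (zeroˡ v)))
        Y₁ Y₂ Y₃ : A
        Y₁ = ratio (c · (z ^ 2)) x≢0
        Y₂ = ratio (x ^ 2) y≢0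
        Y₃ = ratio (y ^ 2) z≢0
        R₁ : Y₁ · x ≡ c · (z ^ 2)
        R₁ = ratio-· _ x≢0
        R₂ : Y₂ · y ≡ x ^ 2
        R₂ = ratio-· _ y≢0
        R₃ : Y₃ · z ≡ y ^ 2
        R₃ = ratio-· _ z≢0
        Y₁≢0 : Y₁ ≢ 0#
        Y₁≢0 = ratio≢0 x≢0 (·-nonzero c≢0 (^-nonzero 2 z≢0))
        Y₂≢0 : Y₂ ≢ 0#
        Y₂≢0 = ratio≢0 y≢0 (^-nonzero 2 x≢0)
        Y₃≢0 : Y₃ ≢ 0#
        Y₃≢0 = ratio≢0 z≢0 (^-nonzero 2 y≢0)
        riccati : ∀ {X Y p q r t} → p ≢ 0# → q ≢ 0# → Y · q ≡ r → X · p ≡ t → (r ^ 2) · t ≡ (q ^ 2) · ((b · t) + (a · p)) →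
                  (Y ^ 2) · X ≡ (b · X) + a
        riccati {X} {Y} {p} {q} p≢0 q≢0 refl refl e = ·-cancelʳ (·-nonzero (^-nonzero 2 q≢0) p≢0) (begin
          ((Y ^ 2) · X) · ((q ^ 2) · p)                   ≡⟨ solve 4 (λ X Y p q → (Y :^ 2 :* X) :* (q :^ 2 :* p) := (Y :* q) :^ 2 :* (X :* p)) refl X Y p q ⟩
          ((Y · q) ^ 2) · (X · p)                         ≡⟨ e ⟩
          (q ^ 2) · ((b · (X · p)) + (a · p))             ≡⟨ solve 5 (λ a b X p q → q :^ 2 :* (b :* (X :* p) :+ a :* p) := (b :* X :+ a) :* (q :^ 2 :* p)) refl a b X p q ⟩
          ((b · X) + a) · ((q ^ 2) · p)                   ∎)
        F₁ : (Y₃ ^ 2) · Y₁ ≡ (b · Y₁) + a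
        F₁ = riccati x≢0 z≢0 R₃ R₁ (trans (solve 3 (λ c y z → (y :^ 2) :^ 2 :* (c :* z :^ 2) := z :^ 2 :* (c :* (y :^ 2) :^ 2)) refl c y z) (cong ((z ^ 2) ·_) E₁))
        F₃ : (Y₂ ^ 2) · Y₃ ≡ (b · Y₃) + a
        F₃ = riccati z≢0 y≢0 R₂ R₃ (trans (*-comm ((x ^ 2) ^ 2) (y ^ 2)) (cong ((y ^ 2) ·_) E₃))
        F₂ : (Y₁ ^ 2) · Y₂ ≡ (b · Y₂) + a
        F₂ = riccati y≢0 x≢0 R₁ R₂ (trans (*-comm ((c · (z ^ 2)) ^ 2) (x ^ 2)) (cong ((x ^ 2) ·_) E₂))
        product : Y₁ · ((Y₂ ^ 4) · (Y₃ ^ 2)) ≡ c · (x ^ 7)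
        product = ·-cancelʳ (·-nonzero x≢0 (·-nonzero (^-nonzero 4 y≢0) (^-nonzero 2 z≢0))) (begin
          (Y₁ · ((Y₂ ^ 4) · (Y₃ ^ 2))) · (x · ((y ^ 4) · (z ^ 2)))
            ≡⟨ solve 6 (λ X Y Z x y z → (X :* (Y :^ 4 :* Z :^ 2)) :* (x :* (y :^ 4 :* z :^ 2)) := (X :* x) :* ((Y :* y) :^ 4 :* (Z :* z) :^ 2)) refl Y₁ Y₂ Y₃ x y z ⟩
          (Y₁ · x) · (((Y₂ · y) ^ 4) · ((Y₃ · z) ^ 2))
            ≡⟨ cong₂ _·_ R₁ (cong₂ (λ u v → (u ^ 4) · (v ^ 2)) R₂ R₃) ⟩
          (c · (z ^ 2)) · (((x ^ 2) ^ 4) · ((y ^ 2) ^ 2))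
            ≡⟨ solve 4 (λ c x y z → (c :* z :^ 2) :* ((x :^ 2) :^ 4 :* (y :^ 2) :^ 2) := (c :* x :^ 7) :* (x :* (y :^ 4 :* z :^ 2))) refl c x y z ⟩
          (c · (x ^ 7)) · (x · ((y ^ 4) · (z ^ 2))) ∎)

      cases : Dec (x ≡ 0#) → Dec (y ≡ 0#) → Dec (z ≡ 0#) → (x , y , z) ≡ 0V
      cases (yes x≡0) (yes y≡0) _         = ext x≡0 y≡0 (x=y=0 x≡0 y≡0)
      cases (yes x≡0) (no  y≢0) _         = ⊥-elim (x=0 x≡0 y≢0)
      cases (no  x≢0) (yes y≡0) _         = ⊥-elim (y=0 y≡0 x≢0)
      cases (no  x≢0) (no  y≢0) (yes z≡0) = ⊥-elim (z=0 z≡0 x≢0 y≢0)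
      cases (no  x≢0) (no  y≢0) (no  z≢0) = ⊥-elim (generic x≢0 y≢0 z≢0)

  cyclicTwist : Twist
  cyclicTwist = let c , c-fixed , free = nonresidue in record
    { σ           = 2
    ; S           = λ (x , y , z) → c · (z ^ 2) , x ^ 2 , y ^ 2
    ; S-⊕         = λ (x , y , z) (x′ , y′ , z′) → ext
        (solve 3 (λ c z z′ → c :* (z :+ z′) :^ 2 := c :* z :^ 2 :+ c :* z′ :^ 2) refl c z z′) (frobenius x x′) (frobenius y y′)
    ; S-⊙         = λ a (x , y , z) → ext
        (solve 3 (λ a c z → c :* (a :* z) :^ 2 := a :^ 2 :* (c :* z :^ 2)) refl a c z) (^-distrib-* a x 2) (^-distrib-* a y 2)
    ; S-fixed     = λ (fx , fy , fz) → Fixed-· c-fixed (Fixed-² fz) , Fixed-² fx , Fixed-² fy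
    ; σ-fixed     = λ {a} e → idempotent a e (a ≟ᶠ 0#)
    ; S-kernel    = λ e → ext (root (cong (proj₁ ∘ proj₂) e)) (root (cong (proj₂ ∘ proj₂) e)) (c-root c (free⇒≢0 free) (cong proj₁ e))
    ; irreducible = λ a≢0 e → cyclic-irreducible free a≢0 (cong proj₁ e) (cong (proj₁ ∘ proj₂) e) (cong (proj₂ ∘ proj₂) e)
    }
    where
    Fixed-² : ∀ {x} → Fixed x → Fixed (x ^ 2)
    Fixed-² {x} fx = trans (^-comm x 2 s) (cong (_^ 2) fx)
    idempotent : ∀ a → a ^ 2 ≡ a → Dec (a ≡ 0#) → a ≡ 0# ⊎ a ≡ 1#
    idempotent a e (yes a≡0) = inj₁ a≡0
    idempotent a e (no  a≢0) = inj₂ (·-cancelʳ a≢0 (trans (solve 1 (λ a → a :* a := a :^ 2) refl a) (trans e (sym (*-identityˡ a)))))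
    root : ∀ {x} → x ^ 2 ≡ 0# → x ≡ 0#
    root {x} e = dec (x ≟ᶠ 0#)
      where dec : Dec (x ≡ 0#) → x ≡ 0#
            dec (yes p)   = p
            dec (no  x≢0) = contradiction e (^-nonzero 2 x≢0)
    c-root : ∀ c {x} → c ≢ 0# → c · (x ^ 2) ≡ 0# → x ≡ 0#
    c-root c {x} c≢0 e = root (·-cancelʳ c≢0 (trans (*-comm _ c) (trans e (sym (zeroˡ c)))))

-- The case 3 ∤ k, where q ≡ 2 or 4 modulo 7: the cubic extension F[α].

Residue : ℕ → Set
Residue e = ∃ λ N → e ≡ 2 ℕ.+ N ℕ.* 7 ⊎ e ≡ 4 ℕ.+ N ℕ.* 7

Residue-square : ∀ {e} → Residue e → Residue (e ℕ.* e)
Residue-square (N , inj₁ refl) = N ℕ.* (4 ℕ.+ N ℕ.* 7) , inj₂ (lemma N)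
  where
  lemma : ∀ N → (2 ℕ.+ N ℕ.* 7) ℕ.* (2 ℕ.+ N ℕ.* 7) ≡ 4 ℕ.+ (N ℕ.* (4 ℕ.+ N ℕ.* 7)) ℕ.* 7
  lemma = solve-∀
Residue-square (N , inj₂ refl) = 2 ℕ.+ N ℕ.* (8 ℕ.+ N ℕ.* 7) , inj₁ (lemma N)
  where
  lemma : ∀ N → (4 ℕ.+ N ℕ.* 7) ℕ.* (4 ℕ.+ N ℕ.* 7) ≡ 2 ℕ.+ (2 ℕ.+ N ℕ.* (8 ℕ.+ N ℕ.* 7)) ℕ.* 7
  lemma = solve-∀

module KummerTwist {A : Set} {_+_ _·_ : Op₂ A} { -_ : Op₁ A} {0# 1# : A}
    (isCR : IsCommutativeRing _≡_ _+_ _·_ -_ 0# 1#) (1+1≡0 : (1# + 1#) ≡ 0#) (0≢1 : 0# ≢ 1#)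
    (unit : ∀ x → x ≢ 0# → ∃ λ y → (x · y) ≡ 1#) (zero? : ∀ x → Dec (x ≡ 0#)) where

  open Char2 isCR 1+1≡0
  open Units isCR 0≢1 unit
  open SeventhPowers isCR 1+1≡0 0≢1 unit

  -- Equality would make Y^(e-1) a quotient of seventh powers, but e - 1 is 1 or 3 modulo 7, which
  -- `SeventhFree` and `free-³` exclude.
  not-conjugate : ∀ {Y u v e} → SeventhFree Y → Residue e → u ≢ 0# → v ≢ 0# → (Y · (u ^ 7)) ≢ ((Y ^ e) · (v ^ 7))
  not-conjugate {Y} {u} {v} free (N , inj₁ refl) u≢0 v≢0 eq =
    free ((Y ^ N) · v) u (·-nonzero (^-nonzero N Y≢0) v≢0) (·-cancelʳ Y≢0 (begin
      (Y · (((Y ^ N) · v) ^ 7)) · Y             ≡⟨ solve 3 (λ y w v → (y :* (w :* v) :^ 7) :* y := (y :^ 2 :* w :^ 7) :* v :^ 7) refl Y (Y ^ N) v ⟩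
      ((Y ^ 2) · ((Y ^ N) ^ 7)) · (v ^ 7)       ≡⟨ cong (_· (v ^ 7)) (^-mod7 Y 2 N) ⟨
      (Y ^ (2 ℕ.+ N ℕ.* 7)) · (v ^ 7)           ≡⟨ eq ⟨
      Y · (u ^ 7)                               ≡⟨ *-comm Y _ ⟩
      (u ^ 7) · Y                               ∎))
    where
    open ≡-Reasoning
    Y≢0 = free⇒≢0 free
  not-conjugate {Y} {u} {v} free (N , inj₂ refl) u≢0 v≢0 eq =
    free-³ free ((Y ^ N) · v) u (·-nonzero (^-nonzero N Y≢0) v≢0) (·-cancelʳ Y≢0 (begin
      ((Y ^ 3) · (((Y ^ N) · v) ^ 7)) · Y       ≡⟨ solve 3 (λ y w v → (y :^ 3 :* (w :* v) :^ 7) :* y := (y :^ 4 :* w :^ 7) :* v :^ 7) refl Y (Y ^ N) v ⟩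
      ((Y ^ 4) · ((Y ^ N) ^ 7)) · (v ^ 7)       ≡⟨ cong (_· (v ^ 7)) (^-mod7 Y 4 N) ⟨
      (Y ^ (4 ℕ.+ N ℕ.* 7)) · (v ^ 7)           ≡⟨ eq ⟨
      Y · (u ^ 7)                               ≡⟨ *-comm Y _ ⟩
      (u ^ 7) · Y                               ∎))
    where
    open ≡-Reasoning
    Y≢0 = free⇒≢0 free

  twist-· : ∀ m a v → (m · ((a · v) ^ 8)) ≡ ((a ^ 8) · (m · (v ^ 8)))
  twist-· = solve 3 (λ m a v → m :* (a :* v) :^ 8 := a :^ 8 :* (m :* v :^ 8)) refl

  -- Y = m v⁷ satisfies Y⁹ = bY + a, and so does its conjugate Z = Y^q. Subtracting,
  -- (Y + Z)⁷ Y Z = a unless Y = Z; conjugating once more makes Y^(q²) / Y a seventh power.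
  twist-irreducible : ∀ h → Residue (2 ℕ.^ h) → ∀ {m a b v} → SeventhFree m → a ≢ 0# →
    a ^ (2 ℕ.^ h) ≡ a → b ^ (2 ℕ.^ h) ≡ b →
    (m · ((m · (v ^ 8)) ^ 8)) ≡ ((b · (m · (v ^ 8))) + (a · v)) → v ≡ 0#
  twist-irreducible h res {m} {a} {b} {v} free a≢0 aq≡a bq≡b eq = start (zero? v)
    where
    open ≡-Reasoning
    q : ℕ
    q = 2 ℕ.^ h
    start : Dec (v ≡ 0#) → v ≡ 0#
    start (yes v≡0) = v≡0
    start (no v≢0)  = ⊥-elim (cases (zero? d))
      where
      Y Z d : A
      Y = m · (v ^ 7)
      Z = Y ^ q
      d = Y + Z
      Y-free : SeventhFree Y
      Y-free = free-·⁷ v≢0 free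
      Y≢0 : Y ≢ 0#
      Y≢0 = free⇒≢0 Y-free
      Y⁹ : Y ^ 9 ≡ ((b · Y) + a)
      Y⁹ = ·-cancelʳ v≢0 (begin
        (Y ^ 9) · v                           ≡⟨ solve 2 (λ m v → (m :* v :^ 7) :^ 9 :* v := m :* (m :* v :^ 8) :^ 8) refl m v ⟩
        m · ((m · (v ^ 8)) ^ 8)               ≡⟨ eq ⟩
        (b · (m · (v ^ 8))) + (a · v)         ≡⟨ solve 4 (λ a b m v → b :* (m :* v :^ 8) :+ a :* v := (b :* (m :* v :^ 7) :+ a) :* v) refl a b m v ⟩
        ((b · Y) + a) · v                     ∎)
      Z⁹ : Z ^ 9 ≡ ((b · Z) + a)
      Z⁹ = begin
        Z ^ 9                     ≡⟨ ^-comm Y q 9 ⟩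
        (Y ^ 9) ^ q               ≡⟨ cong (_^ q) Y⁹ ⟩
        ((b · Y) + a) ^ q         ≡⟨ frobenius^ h (b · Y) a ⟩
        ((b · Y) ^ q) + (a ^ q)   ≡⟨ cong₂ _+_ (trans (^-distrib-* b Y q) (cong (_· Z) bq≡b)) aq≡a ⟩
        (b · Z) + a               ∎
      d⁸ : ((d ^ 8) · (Y · Z)) ≡ (a · d)
      d⁸ = begin
        (d ^ 8) · (Y · Z)                             ≡⟨ solve 2 (λ y z → (y :+ z) :^ 8 :* (y :* z) := y :^ 9 :* z :+ z :^ 9 :* y) refl Y Z ⟩
        ((Y ^ 9) · Z) + ((Z ^ 9) · Y)                 ≡⟨ cong₂ (λ u w → (u · Z) + (w · Y)) Y⁹ Z⁹ ⟩
        (((b · Y) + a) · Z) + (((b · Z) + a) · Y)     ≡⟨ solve 4 (λ a b y z → (b :* y :+ a) :* z :+ (b :* z :+ a) :* y := a :* (y :+ z)) refl a b Y Z ⟩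
        a · d                                         ∎
      cases : Dec (d ≡ 0#) → ⊥
      cases (yes d≡0) = not-conjugate Y-free res (0≢1 ∘ sym) (0≢1 ∘ sym) (cong (_· (1# ^ 7)) (x+y≡0⇒x≡y d≡0))
      cases (no d≢0)  = not-conjugate Y-free (Residue-square res) d≢0 (^-nonzero q d≢0) (·-cancelʳ (^-nonzero q Y≢0) (begin
        (Y · (d ^ 7)) · Z                             ≡⟨ solve 3 (λ y d z → (y :* d :^ 7) :* z := d :^ 7 :* (y :* z)) refl Y d Z ⟩
        (d ^ 7) · (Y · Z)                             ≡⟨ d⁷ ⟩
        a                                             ≡⟨ aq≡a ⟨
        a ^ q                                         ≡⟨ cong (_^ q) d⁷ ⟨
        ((d ^ 7) · (Y · Z)) ^ q                       ≡⟨ trans (^-distrib-* (d ^ 7) (Y · Z) q) (cong₂ _·_ (^-comm d 7 q) (^-distrib-* Y Z q)) ⟩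
        ((d ^ q) ^ 7) · (Z · (Z ^ q))                 ≡⟨ cong (λ w → ((d ^ q) ^ 7) · (Z · w)) (^-assocʳ Y q q) ⟩
        ((d ^ q) ^ 7) · (Z · (Y ^ (q ℕ.* q)))         ≡⟨ solve 3 (λ d z w → d :^ 7 :* (z :* w) := (w :* d :^ 7) :* z) refl (d ^ q) Z (Y ^ (q ℕ.* q)) ⟩
        ((Y ^ (q ℕ.* q)) · ((d ^ q) ^ 7)) · Z         ∎))
        where
        d⁷ : ((d ^ 7) · (Y · Z)) ≡ a
        d⁷ = ·-cancelʳ d≢0 (trans (solve 2 (λ d w → (d :^ 7 :* w) :* d := d :^ 8 :* w) refl d (Y · Z)) d⁸)

module CubicTwist {n} (F : FiniteField (suc n)) (k : ℕ) (0<k : 0 < k) (q≡ss : suc n ≡ 2 ℕ.^ k ℕ.* 2 ℕ.^ k)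
                  (residue : Residue (suc n)) where
  open QuadraticExtension F k 0<k q≡ss
  open Families F k 0<k q≡ss

  -- Write q - 1 = r + 7 N with r = 1 or 3. From x^(q-1) = y^(q-1) and x⁷ = y⁷ follows x^r = y^r;
  -- for r = 3 the identity x · (x³)² = x⁷ recovers x.
  seventh-injective : ∀ {x y} → x ≢ 0# → y ≢ 0# → x ^ 7 ≡ y ^ 7 → x ≡ y
  seventh-injective {x} {y} x≢0 y≢0 e = root residue
    where
    open ≡-Reasoning
    xy : ∀ r N → suc n ≡ suc r ℕ.+ N ℕ.* 7 → x ^ r ≡ y ^ r
    xy r N n≡ = ·-cancelʳ (^-nonzero 7 (^-nonzero N y≢0)) (begin
      (x ^ r) · ((y ^ N) ^ 7)   ≡⟨ cong ((x ^ r) ·_) (trans (^-comm x N 7) (trans (cong (_^ N) e) (^-comm y 7 N))) ⟨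
      (x ^ r) · ((x ^ N) ^ 7)   ≡⟨ power x ⟨
      x ^ n                     ≡⟨ trans (x^[q-1]≡1 x≢0) (sym (x^[q-1]≡1 y≢0)) ⟩
      y ^ n                     ≡⟨ power y ⟩
      (y ^ r) · ((y ^ N) ^ 7)   ∎)
      where
      power : ∀ x → x ^ n ≡ (x ^ r) · ((x ^ N) ^ 7)
      power x = trans (cong (x ^_) (ℕₚ.suc-injective n≡)) (trans (^-homo-* x r (N ℕ.* 7)) (cong ((x ^ r) ·_) (sym (^-assocʳ x N 7))))
    root : Residue (suc n) → x ≡ y
    root (N , inj₁ n≡) = trans (sym (*-identityʳ x)) (trans (xy 1 N n≡) (*-identityʳ y))
    root (N , inj₂ n≡) = ·-cancelʳ (^-nonzero 2 (^-nonzero 3 y≢0)) (begin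
      x · ((y ^ 3) ^ 2)   ≡⟨ cong (λ t → x · (t ^ 2)) (xy 3 N n≡) ⟨
      x · ((x ^ 3) ^ 2)   ≡⟨ solve 1 (λ x → x :* (x :^ 3) :^ 2 := x :^ 7) refl x ⟩
      x ^ 7               ≡⟨ e ⟩
      y ^ 7               ≡⟨ solve 1 (λ x → x :* (x :^ 3) :^ 2 := x :^ 7) refl y ⟨
      y · ((y ^ 3) ^ 2)   ∎)

  -- The homogenised polynomial α³ + α + 1 divides x⁷ - y⁷.
  no-root : ∀ {x y} → y ≢ 0# → (x ^ 3) + ((x · (y ^ 2)) + (y ^ 3)) ≢ 0#
  no-root {x} {y} y≢0 e = cases (x ≟ᶠ 0#)
    where
    open ≡-Reasoning
    equal : ∀ {x} → x ≡ y → (x ^ 3) + ((x · (y ^ 2)) + (y ^ 3)) ≡ 0# → ⊥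
    equal refl e = ^-nonzero 3 y≢0 (trans (solve 1 (λ y → y :^ 3 := y :^ 3 :+ (y :* y :^ 2 :+ y :^ 3)) refl y) e)
    cases : Dec (x ≡ 0#) → ⊥
    cases (yes x≡0) = ^-nonzero 3 y≢0 (trans (solve 1 (λ y → y :^ 3 := con false :^ 3 :+ (con false :* y :^ 2 :+ y :^ 3)) refl y)
      (trans (cong (λ x → (x ^ 3) + ((x · (y ^ 2)) + (y ^ 3))) (sym x≡0)) e))
    cases (no x≢0) = equal (seventh-injective x≢0 y≢0 (x+y≡0⇒x≡y (begin
      (x ^ 7) + (y ^ 7)
        ≡⟨ solve 2 (λ x y → x :^ 7 :+ y :^ 7 := (x :^ 3 :+ (x :* y :^ 2 :+ y :^ 3)) :* (x :^ 4 :+ x :^ 2 :* y :^ 2 :+ x :* y :^ 3 :+ y :^ 4)) refl x y ⟩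
      ((x ^ 3) + ((x · (y ^ 2)) + (y ^ 3))) · ((((x ^ 4) + ((x ^ 2) · (y ^ 2))) + (x · (y ^ 3))) + (y ^ 4))
        ≡⟨ trans (cong (_· ((((x ^ 4) + ((x ^ 2) · (y ^ 2))) + (x · (y ^ 3))) + (y ^ 4))) e) (zeroˡ _) ⟩
      0# ∎))) e

  infixl 7 _⊗_

  embed : A → V
  embed a = a , 0# , 0#

  1V : V
  1V = embed 1#

  abstract
    -- V as the field A[α] with α³ = α + 1.
    _⊗_ : V → V → V
    (x₀ , x₁ , x₂) ⊗ (y₀ , y₁ , y₂) =
      (x₀ · y₀) + ((x₁ · y₂) + (x₂ · y₁)) ,
      (((x₀ · y₁) + (x₁ · y₀)) + ((x₁ · y₂) + (x₂ · y₁))) + (x₂ · y₂) ,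
      ((x₀ · y₂) + ((x₁ · y₁) + (x₂ · y₀))) + (x₂ · y₂)

    ⊗-assoc : ∀ u v w → (u ⊗ v) ⊗ w ≡ u ⊗ (v ⊗ w)
    ⊗-assoc (a , b , c) (d , e , f) (g , h , i) = ext
      (solve 9 (λ a b c d e f g h i →
        let x = a :* d :+ (b :* f :+ c :* e) ; y = a :* e :+ b :* d :+ (b :* f :+ c :* e) :+ c :* f ; z = a :* f :+ (b :* e :+ c :* d) :+ c :* f
            p = d :* g :+ (e :* i :+ f :* h) ; q = d :* h :+ e :* g :+ (e :* i :+ f :* h) :+ f :* i ; r = d :* i :+ (e :* h :+ f :* g) :+ f :* i
        in x :* g :+ (y :* i :+ z :* h) := a :* p :+ (b :* r :+ c :* q)) refl a b c d e f g h i)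
      (solve 9 (λ a b c d e f g h i →
        let x = a :* d :+ (b :* f :+ c :* e) ; y = a :* e :+ b :* d :+ (b :* f :+ c :* e) :+ c :* f ; z = a :* f :+ (b :* e :+ c :* d) :+ c :* f
            p = d :* g :+ (e :* i :+ f :* h) ; q = d :* h :+ e :* g :+ (e :* i :+ f :* h) :+ f :* i ; r = d :* i :+ (e :* h :+ f :* g) :+ f :* i
        in x :* h :+ y :* g :+ (y :* i :+ z :* h) :+ z :* i := a :* q :+ b :* p :+ (b :* r :+ c :* q) :+ c :* r) refl a b c d e f g h i)
      (solve 9 (λ a b c d e f g h i →
        let x = a :* d :+ (b :* f :+ c :* e) ; y = a :* e :+ b :* d :+ (b :* f :+ c :* e) :+ c :* f ; z = a :* f :+ (b :* e :+ c :* d) :+ c :* f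
            p = d :* g :+ (e :* i :+ f :* h) ; q = d :* h :+ e :* g :+ (e :* i :+ f :* h) :+ f :* i ; r = d :* i :+ (e :* h :+ f :* g) :+ f :* i
        in x :* i :+ (y :* h :+ z :* g) :+ z :* i := a :* r :+ (b :* q :+ c :* p) :+ c :* r) refl a b c d e f g h i)

    ⊗-comm : ∀ u v → u ⊗ v ≡ v ⊗ u
    ⊗-comm (a , b , c) (d , e , f) = ext
      (solve 6 (λ a b c d e f → a :* d :+ (b :* f :+ c :* e) := d :* a :+ (e :* c :+ f :* b)) refl a b c d e f)
      (solve 6 (λ a b c d e f → a :* e :+ b :* d :+ (b :* f :+ c :* e) :+ c :* f := d :* b :+ e :* a :+ (e :* c :+ f :* b) :+ f :* c) refl a b c d e f)
      (solve 6 (λ a b c d e f → a :* f :+ (b :* e :+ c :* d) :+ c :* f := d :* c :+ (e :* b :+ f :* a) :+ f :* c) refl a b c d e f)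

    embed-⊗ : ∀ a v → embed a ⊗ v ≡ a ⊙ v
    embed-⊗ a (x , y , z) = ext
      (solve 4 (λ a x y z → a :* x :+ (con false :* z :+ con false :* y) := a :* x) refl a x y z)
      (solve 4 (λ a x y z → a :* y :+ con false :* x :+ (con false :* z :+ con false :* y) :+ con false :* z := a :* y) refl a x y z)
      (solve 4 (λ a x y z → a :* z :+ (con false :* y :+ con false :* x) :+ con false :* z := a :* z) refl a x y z)

    -- The second factor is the product of the other two conjugates of x + y α, so the right-hand
    -- side is the norm of x + y α, the form treated in `no-root`.
    linear-norm : ∀ x y → (x , y , 0#) ⊗ ((x ^ 2) + (y ^ 2) , x · y , y ^ 2) ≡ embed ((x ^ 3) + ((x · (y ^ 2)) + (y ^ 3)))
    linear-norm x y = ext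
      (solve 2 (λ x y → x :* (x :^ 2 :+ y :^ 2) :+ (y :* y :^ 2 :+ con false :* (x :* y)) := x :^ 3 :+ (x :* y :^ 2 :+ y :^ 3)) refl x y)
      (solve 2 (λ x y → x :* (x :* y) :+ y :* (x :^ 2 :+ y :^ 2) :+ (y :* y :^ 2 :+ con false :* (x :* y)) :+ con false :* y :^ 2 := con false) refl x y)
      (solve 2 (λ x y → x :* y :^ 2 :+ (y :* (x :* y) :+ con false :* (x :^ 2 :+ y :^ 2)) :+ con false :* y :^ 2 := con false) refl x y)

    -- The factor y + z α is chosen to cancel the coefficient of α², which brings the inversion down
    -- to degree at most 1 in α.
    quadratic-reduce : ∀ x y z → (x , y , z) ⊗ (y , z , 0#) ≡ ((x · y) + (z ^ 2) , (x · z) + ((y ^ 2) + (z ^ 2)) , 0#)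
    quadratic-reduce x y z = ext
      (solve 3 (λ x y z → x :* y :+ (y :* con false :+ z :* z) := x :* y :+ z :^ 2) refl x y z)
      (solve 3 (λ x y z → x :* z :+ y :* y :+ (y :* con false :+ z :* z) :+ z :* con false := x :* z :+ (y :^ 2 :+ z :^ 2)) refl x y z)
      (solve 3 (λ x y z → x :* con false :+ (y :* z :+ z :* y) :+ z :* con false := con false) refl x y z)

    α⊗ : ∀ x y z → (0# , 1# , 0#) ⊗ (x , y , z) ≡ (z , x + z , y)
    α⊗ x y z = ext
      (solve 3 (λ x y z → con false :* x :+ (con true :* z :+ con false :* y) := z) refl x y z)
      (solve 3 (λ x y z → con false :* y :+ con true :* x :+ (con true :* z :+ con false :* y) :+ con false :* z := x :+ z) refl x y z)
      (solve 3 (λ x y z → con false :* z :+ (con true :* y :+ con false :* x) :+ con false :* z := y) refl x y z)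

    ⊗-square : ∀ x y z → (x , y , z) ⊗ (x , y , z) ≡ (x ^ 2 , z ^ 2 , (y ^ 2) + (z ^ 2))
    ⊗-square x y z = ext
      (solve 3 (λ x y z → x :* x :+ (y :* z :+ z :* y) := x :^ 2) refl x y z)
      (solve 3 (λ x y z → x :* y :+ y :* x :+ (y :* z :+ z :* y) :+ z :* z := z :^ 2) refl x y z)
      (solve 3 (λ x y z → x :* z :+ (y :* y :+ z :* x) :+ z :* z := y :^ 2 :+ z :^ 2) refl x y z)

    ⊗-distribˡ : ∀ u v w → u ⊗ (v ⊕ w) ≡ (u ⊗ v) ⊕ (u ⊗ w)
    ⊗-distribˡ (a , b , c) (d , e , f) (g , h , i) = ext
      (solve 9 (λ a b c d e f g h i → a :* (d :+ g) :+ (b :* (f :+ i) :+ c :* (e :+ h))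
        := (a :* d :+ (b :* f :+ c :* e)) :+ (a :* g :+ (b :* i :+ c :* h))) refl a b c d e f g h i)
      (solve 9 (λ a b c d e f g h i → a :* (e :+ h) :+ b :* (d :+ g) :+ (b :* (f :+ i) :+ c :* (e :+ h)) :+ c :* (f :+ i)
        := (a :* e :+ b :* d :+ (b :* f :+ c :* e) :+ c :* f) :+ (a :* h :+ b :* g :+ (b :* i :+ c :* h) :+ c :* i)) refl a b c d e f g h i)
      (solve 9 (λ a b c d e f g h i → a :* (f :+ i) :+ (b :* (e :+ h) :+ c :* (d :+ g)) :+ c :* (f :+ i)
        := (a :* f :+ (b :* e :+ c :* d) :+ c :* f) :+ (a :* i :+ (b :* h :+ c :* g) :+ c :* i)) refl a b c d e f g h i)

    ⊗-identityˡ : ∀ v → 1V ⊗ v ≡ v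
    ⊗-identityˡ v = trans (embed-⊗ 1# v) (ext (*-identityˡ _) (*-identityˡ _) (*-identityˡ _))

    ⊕-⊗-isCommutativeRing : IsCommutativeRing _≡_ _⊕_ _⊗_ (λ v → v) 0V 1V
    ⊕-⊗-isCommutativeRing = record
      { isRing = record
        { +-isAbelianGroup = record
          { isGroup = record
            { isMonoid = record
              { isSemigroup = record
                { isMagma = record { isEquivalence = isEquivalence ; ∙-cong = cong₂ _⊕_ }
                ; assoc = λ _ _ _ → ext (+-assoc _ _ _) (+-assoc _ _ _) (+-assoc _ _ _)
                }
              ; identity = (λ _ → ext (+-identityˡ _) (+-identityˡ _) (+-identityˡ _)) , (λ _ → ext (+-identityʳ _) (+-identityʳ _) (+-identityʳ _))
              }
            ; inverse = (λ _ → ext (x+x≡0 _) (x+x≡0 _) (x+x≡0 _)) , (λ _ → ext (x+x≡0 _) (x+x≡0 _) (x+x≡0 _))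
            ; ⁻¹-cong = λ e → e
            }
          ; comm = λ _ _ → ext (+-comm _ _) (+-comm _ _) (+-comm _ _)
          }
        ; *-cong = cong₂ _⊗_
        ; *-assoc = ⊗-assoc
        ; *-identity = ⊗-identityˡ , λ v → trans (⊗-comm v 1V) (⊗-identityˡ v)
        ; distrib = ⊗-distribˡ , λ u v w → trans (⊗-comm (v ⊕ w) u) (trans (⊗-distribˡ u v w) (cong₂ _⊕_ (⊗-comm u v) (⊗-comm u w)))
        }
      ; *-comm = ⊗-comm
      }

    1V⊕1V≡0V : 1V ⊕ 1V ≡ 0V
    1V⊕1V≡0V = ext (x+x≡0 _) (x+x≡0 _) (x+x≡0 _)

  0V≢1V : 0V ≢ 1V
  0V≢1V e = 0≢1 (cong proj₁ e)

  private
    module L = Char2 ⊕-⊗-isCommutativeRing 1V⊕1V≡0V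

  IsUnit : V → Set
  IsUnit u = ∃ λ w → u ⊗ w ≡ 1V

  unit-factor : ∀ {u v} → IsUnit (u ⊗ v) → IsUnit u
  unit-factor {u} {v} (w , e) = v ⊗ w , trans (sym (⊗-assoc u v w)) e

  embed-unit : ∀ {a} → a ≢ 0# → IsUnit (embed a)
  embed-unit {a} a≢0 = let b , ab≡1 = unit a a≢0 in
    embed b , trans (embed-⊗ a (embed b)) (ext ab≡1 (zeroʳ a) (zeroʳ a))

  linear-unit : ∀ {x y} → y ≢ 0# → IsUnit (x , y , 0#)
  linear-unit {x} {y} y≢0 = unit-factor {v = (x ^ 2) + (y ^ 2) , x · y , y ^ 2} (subst IsUnit (sym (linear-norm x y)) (embed-unit (no-root y≢0)))

  -- Degree at most 1 in α is settled by norms. In degree 2 the product with y + z α has degree at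
  -- most 1, and it cannot vanish, because y + z α is itself a unit and v ≠ 0.
  unitV : ∀ v → v ≢ 0V → IsUnit v
  unitV (x , y , z) v≢0 = cases (z ≟ᶠ 0#) (y ≟ᶠ 0#)
    where
    open ≡-Reasoning
    cases : Dec (z ≡ 0#) → Dec (y ≡ 0#) → IsUnit (x , y , z)
    cases (yes refl) (yes refl) = embed-unit (λ x≡0 → v≢0 (ext x≡0 refl refl))
    cases (yes refl) (no y≢0)   = linear-unit y≢0
    cases (no z≢0)   _          = unit-factor {v = y , z , 0#} (subst IsUnit (sym reduce) (reduced (p ≟ᶠ 0#) (r ≟ᶠ 0#)))
      where
      p r : A
      p = (x · y) + (z ^ 2)
      r = (x · z) + ((y ^ 2) + (z ^ 2))
      reduce = quadratic-reduce x y z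
      reduced : Dec (p ≡ 0#) → Dec (r ≡ 0#) → IsUnit (p , r , 0#)
      reduced _ (no r≢0)          = linear-unit r≢0
      reduced (no p≢0) (yes r≡0)  = subst (λ r → IsUnit (p , r , 0#)) (sym r≡0) (embed-unit p≢0)
      reduced (yes p≡0) (yes r≡0) = ⊥-elim (v≢0 (begin
        v                               ≡⟨ L.*-identityʳ v ⟨
        v ⊗ 1V                          ≡⟨ cong (v ⊗_) (proj₂ linear) ⟨
        v ⊗ ((y , z , 0#) ⊗ w)          ≡⟨ ⊗-assoc v (y , z , 0#) w ⟨
        (v ⊗ (y , z , 0#)) ⊗ w          ≡⟨ cong (_⊗ w) (trans reduce (ext p≡0 r≡0 refl)) ⟩
        0V ⊗ w                          ≡⟨ L.zeroˡ w ⟩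
        0V                              ∎))
        where
        v : V
        v = x , y , z
        linear : IsUnit (y , z , 0#)
        linear = linear-unit z≢0
        w : V
        w = proj₁ linear

  private
    zeroV? : ∀ v → Dec (v ≡ 0V)
    zeroV? v = ≡-dec _≟ᶠ_ (≡-dec _≟ᶠ_ _≟ᶠ_) v 0V

    module U = Units ⊕-⊗-isCommutativeRing 0V≢1V unitV
    open SeventhPowers ⊕-⊗-isCommutativeRing 1V⊕1V≡0V 0V≢1V unitV
    open KummerTwist ⊕-⊗-isCommutativeRing 1V⊕1V≡0V 0V≢1V unitV zeroV?

  α : V
  α = 0# , 1# , 0#

  α³≡α+1 : α L.^ 3 ≡ α ⊕ 1V
  α³≡α+1 = begin
    α ⊗ (α ⊗ (α ⊗ 1V))                            ≡⟨ cong (λ v → α ⊗ (α ⊗ v)) (α⊗ 1# 0# 0#) ⟩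
    α ⊗ (α ⊗ (0# , 1# + 0# , 0#))                 ≡⟨ cong (α ⊗_) (α⊗ 0# (1# + 0#) 0#) ⟩
    α ⊗ (0# , 0# + 0# , 1# + 0#)                  ≡⟨ α⊗ 0# (0# + 0#) (1# + 0#) ⟩
    (1# + 0# , 0# + (1# + 0#) , 0# + 0#)          ≡⟨ ext (+-comm 1# 0#) (+-comm 0# (1# + 0#)) refl ⟩
    (0# + 1# , (1# + 0#) + 0# , 0# + 0#)          ≡⟨ ext refl (+-identityʳ _) refl ⟩
    α ⊕ 1V                                        ∎
    where open ≡-Reasoning

  α⁷≡1 : α L.^ 7 ≡ 1V
  α⁷≡1 = x³≡x+1⇒x⁷≡1 α³≡α+1

  α≢1 : α ≢ 1V
  α≢1 e = 0≢1 (cong proj₁ e)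

  private
    size : ℕ
    size = suc n ℕ.* (suc n ℕ.* suc n)

    encode : V → Fin size
    encode (x , y , z) = combine x (combine y z)

    decode : Fin size → V
    decode i = let x , j = remQuot (suc n ℕ.* suc n) i in x , remQuot {suc n} (suc n) j

    decode-encode : ∀ v → decode (encode v) ≡ v
    decode-encode (x , y , z) = trans
      (cong (λ (x , j) → x , remQuot {suc n} (suc n) j) (remQuot-combine {suc n} x (combine y z)))
      (cong (x ,_) (remQuot-combine {suc n} y z))

    encode-decode : ∀ i → encode (decode i) ≡ i
    encode-decode i = let x , j = remQuot {suc n} (suc n ℕ.* suc n) i in
      trans (cong (combine x) (combine-remQuot {suc n} (suc n) j)) (combine-remQuot {suc n} (suc n ℕ.* suc n) i)

    encode-injective : ∀ {u v} → encode u ≡ encode v → u ≡ v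
    encode-injective {u} {v} e = trans (sym (decode-encode u)) (trans (cong decode e) (decode-encode v))

    seventh : Fin size → Fin size
    seventh i = encode (decode i L.^ 7)

    seventh-encode : ∀ v → seventh (encode v) ≡ encode (v L.^ 7)
    seventh-encode v = cong (λ u → encode (u L.^ 7)) (decode-encode v)

  -- The seventh power map is not injective, as α⁷ = 1; hence it is not surjective.
  not-surjective : ¬ (∀ y → ∃ λ x → seventh x ≡ y)
  not-surjective onto = α≢1 (encode-injective (begin
    encode α                  ≡⟨ proj₂ (section-onto (encode α)) ⟨
    section xα                ≡⟨ cong section xα≡x1 ⟩
    section x1                ≡⟨ proj₂ (section-onto (encode 1V)) ⟩
    encode 1V                 ∎))
    where
    open ≡-Reasoning
    -- A right inverse of `seventh` is injective, hence onto by counting, so every element would be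
    -- recovered from its seventh power.
    section : Fin size → Fin size
    section y = proj₁ (onto y)
    section-onto : ∀ x → ∃ λ y → section y ≡ x
    section-onto = injective⇒surjective ℕₚ.≤-refl section (λ {i} {j} e → trans (sym (proj₂ (onto i))) (trans (cong seventh e) (proj₂ (onto j))))
    xα x1 : Fin size
    xα = proj₁ (section-onto (encode α))
    x1 = proj₁ (section-onto (encode 1V))
    image : ∀ v → proj₁ (section-onto (encode v)) ≡ encode (v L.^ 7)
    image v = begin
      proj₁ (section-onto (encode v))                       ≡⟨ proj₂ (onto _) ⟨
      seventh (section (proj₁ (section-onto (encode v))))   ≡⟨ cong seventh (proj₂ (section-onto (encode v))) ⟩
      seventh (encode v)                                    ≡⟨ seventh-encode v ⟩
      encode (v L.^ 7)                                      ∎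
    xα≡x1 : xα ≡ x1
    xα≡x1 = trans (image α) (trans (cong encode (trans α⁷≡1 (sym (L.1^ 7)))) (sym (image 1V)))

  seventhFree : ∃ SeventhFree
  seventhFree = decode i , not-seventh⇒free (λ w w⁷≡m → proj₂ hole (encode w , trans (seventh-encode w) (trans (cong encode w⁷≡m) (encode-decode i))))
    where
    hole : ∃ λ y → ¬ (∃ λ x → seventh x ≡ y)
    hole = ¬∀⟶∃¬ size (λ y → ∃ λ x → seventh x ≡ y) (λ y → any? (λ x → seventh x ≟ᶠ y)) not-surjective
    i : Fin size
    i = proj₁ hole

  square : ∀ x y z → (x , y , z) L.^ 2 ≡ (x ^ 2 , z ^ 2 , (y ^ 2) + (z ^ 2))
  square x y z = trans (cong ((x , y , z) ⊗_) (L.*-identityʳ (x , y , z))) (⊗-square x y z)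

  -- α⁸ = α, so eighth powers are taken coordinatewise.
  eighth : ∀ x y z → (x , y , z) L.^ 8 ≡ (x ^ 8 , y ^ 8 , z ^ 8)
  eighth x y z = begin
    (x , y , z) L.^ 8
      ≡⟨ trans (L.^-assocʳ ((x , y , z) L.^ 2) 2 2) (L.^-assocʳ (x , y , z) 2 4) ⟨
    (((x , y , z) L.^ 2) L.^ 2) L.^ 2
      ≡⟨ cong (λ v → (v L.^ 2) L.^ 2) (square x y z) ⟩
    ((x ^ 2 , z ^ 2 , (y ^ 2) + (z ^ 2)) L.^ 2) L.^ 2
      ≡⟨ cong (L._^ 2) (square _ _ _) ⟩
    ((x ^ 2) ^ 2 , ((y ^ 2) + (z ^ 2)) ^ 2 , ((z ^ 2) ^ 2) + (((y ^ 2) + (z ^ 2)) ^ 2)) L.^ 2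
      ≡⟨ square _ _ _ ⟩
    _ ≡⟨ ext (solve 1 (λ x → ((x :^ 2) :^ 2) :^ 2 := x :^ 8) refl x)
           (solve 2 (λ y z → ((z :^ 2) :^ 2 :+ (y :^ 2 :+ z :^ 2) :^ 2) :^ 2 := y :^ 8) refl y z)
           (solve 2 (λ y z → ((y :^ 2 :+ z :^ 2) :^ 2) :^ 2 :+ ((z :^ 2) :^ 2 :+ (y :^ 2 :+ z :^ 2) :^ 2) :^ 2 := z :^ 8) refl y z) ⟩
    (x ^ 8 , y ^ 8 , z ^ 8) ∎
    where open ≡-Reasoning

  coordinatewise : ∀ j x y z → (x , y , z) L.^ (2 ℕ.^ (j ℕ.* 3)) ≡ (x ^ (2 ℕ.^ (j ℕ.* 3)) , y ^ (2 ℕ.^ (j ℕ.* 3)) , z ^ (2 ℕ.^ (j ℕ.* 3)))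
  coordinatewise zero    x y z = trans (L.*-identityʳ _) (ext (sym (*-identityʳ x)) (sym (*-identityʳ y)) (sym (*-identityʳ z)))
  coordinatewise (suc j) x y z = begin
    (x , y , z) L.^ e′                        ≡⟨ cong ((x , y , z) L.^_) e′≡8e ⟩
    (x , y , z) L.^ (8 ℕ.* e)                 ≡⟨ L.^-assocʳ (x , y , z) 8 e ⟨
    ((x , y , z) L.^ 8) L.^ e                 ≡⟨ cong (L._^ e) (eighth x y z) ⟩
    (x ^ 8 , y ^ 8 , z ^ 8) L.^ e             ≡⟨ coordinatewise j (x ^ 8) (y ^ 8) (z ^ 8) ⟩
    ((x ^ 8) ^ e , (y ^ 8) ^ e , (z ^ 8) ^ e) ≡⟨ ext (c x) (c y) (c z) ⟩
    (x ^ e′ , y ^ e′ , z ^ e′)                ∎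
    where
    open ≡-Reasoning
    e e′ : ℕ
    e  = 2 ℕ.^ (j ℕ.* 3)
    e′ = 2 ℕ.^ (suc j ℕ.* 3)
    e′≡8e : e′ ≡ 8 ℕ.* e
    e′≡8e = lemma e
      where lemma : ∀ t → 2 ℕ.* (2 ℕ.* (2 ℕ.* t)) ≡ 8 ℕ.* t
            lemma = solve-∀
    c : ∀ x → (x ^ 8) ^ e ≡ x ^ e′
    c x = trans (^-assocʳ x 8 e) (cong (x ^_) (sym e′≡8e))

  -- The exponent is s³ = 8^k rather than s: it fixes α, since α⁸ = α, and so acts on coordinates as
  -- `bar` applied three times, which is `bar`. Being a power map, it is compatible with `⊗`.
  barV : V → V
  barV v = v L.^ (2 ℕ.^ (k ℕ.* 3))

  barV≡ : ∀ x y z → barV (x , y , z) ≡ (bar x , bar y , bar z)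
  barV≡ x y z = trans (coordinatewise k x y z) (ext (c x) (c y) (c z))
    where
    open ≡-Reasoning
    c : ∀ x → x ^ (2 ℕ.^ (k ℕ.* 3)) ≡ bar x
    c x = begin
      x ^ (2 ℕ.^ (k ℕ.* 3))       ≡⟨ cong (x ^_) (trans (sym (ℕₚ.^-*-assoc 2 k 3)) (cong (λ t → s ℕ.* (s ℕ.* t)) (ℕₚ.*-identityʳ s))) ⟩
      x ^ (s ℕ.* (s ℕ.* s))       ≡⟨ ^-assocʳ x s (s ℕ.* s) ⟨
      bar x ^ (s ℕ.* s)           ≡⟨ ^-assocʳ (bar x) s s ⟨
      bar (bar (bar x))           ≡⟨ bar-bar (bar x) ⟩
      bar x                       ∎

  barV-barV : ∀ v → barV (barV v) ≡ v
  barV-barV (x , y , z) = trans (cong barV (barV≡ x y z)) (trans (barV≡ _ _ _) (ext (bar-bar x) (bar-bar y) (bar-bar z)))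

  barV⇒FixedV : ∀ {v} → barV v ≡ v → FixedV v
  barV⇒FixedV {x , y , z} e = let p = trans (sym (barV≡ x y z)) e in
    cong proj₁ p , cong (proj₁ ∘ proj₂) p , cong (proj₂ ∘ proj₂) p

  FixedV⇒barV : ∀ {v} → FixedV v → barV v ≡ v
  FixedV⇒barV {x , y , z} (fx , fy , fz) = trans (barV≡ x y z) (ext fx fy fz)

  -- The product of m₀ with its image under the involution `barV` is fixed by it, and as a power of
  -- m₀ it has exponent 1 + 8^k ≡ 2 modulo 7.
  nonresidue : ∃ λ m → barV m ≡ m × SeventhFree m
  nonresidue =
    let m₀ , free = seventhFree
        M , 8^k≡ = 8^j≡1+7M k
    in m₀ ⊗ barV m₀ ,
       trans (L.^-distrib-* m₀ (barV m₀) (2 ℕ.^ (k ℕ.* 3))) (trans (cong (barV m₀ ⊗_) (barV-barV m₀)) (⊗-comm (barV m₀) m₀)) ,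
       subst SeventhFree (cong (λ e → m₀ ⊗ (m₀ L.^ e)) (sym 8^k≡)) (free-^[2+7M] M free)

  embed-^ : ∀ a e → embed a L.^ e ≡ embed (a ^ e)
  embed-^ a zero    = refl
  embed-^ a (suc e) = trans (cong (embed a ⊗_) (embed-^ a e)) (trans (embed-⊗ a (embed (a ^ e))) (ext refl (zeroʳ a) (zeroʳ a)))

  embed-conjugate : ∀ a → embed a L.^ (2 ℕ.^ (k ℕ.+ k)) ≡ embed a
  embed-conjugate a = trans (embed-^ a (2 ℕ.^ (k ℕ.+ k))) (cong embed (trans (cong (a ^_) (sym q≡)) (x^q≡x a)))
    where
    q≡ : suc n ≡ 2 ℕ.^ (k ℕ.+ k)
    q≡ = trans q≡ss (sym (ℕₚ.^-distribˡ-+-* 2 k k))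

  cubicTwist : Twist
  cubicTwist = let m , m-fixed , free = nonresidue in record
    { σ           = 8
    ; S           = λ v → m ⊗ (v L.^ 8)
    ; S-⊕         = λ u v → trans (cong (m ⊗_) (L.frobenius^ 3 u v)) (⊗-distribˡ m (u L.^ 8) (v L.^ 8))
    ; S-⊙         = λ a v → begin
        m ⊗ ((a ⊙ v) L.^ 8)                   ≡⟨ cong (λ u → m ⊗ (u L.^ 8)) (embed-⊗ a v) ⟨
        m ⊗ ((embed a ⊗ v) L.^ 8)             ≡⟨ twist-· m (embed a) v ⟩
        (embed a L.^ 8) ⊗ (m ⊗ (v L.^ 8))     ≡⟨ cong (_⊗ (m ⊗ (v L.^ 8))) (embed-^ a 8) ⟩
        embed (a ^ 8) ⊗ (m ⊗ (v L.^ 8))       ≡⟨ embed-⊗ (a ^ 8) _ ⟩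
        (a ^ 8) ⊙ (m ⊗ (v L.^ 8))             ∎
    ; S-fixed     = λ {v} fv → barV⇒FixedV (trans (L.^-distrib-* m (v L.^ 8) (2 ℕ.^ (k ℕ.* 3)))
        (cong₂ _⊗_ m-fixed (trans (L.^-comm v 8 (2 ℕ.^ (k ℕ.* 3))) (cong (L._^ 8) (FixedV⇒barV fv)))))
    ; σ-fixed     = λ {a} e → eighth-fixed a e (a ≟ᶠ 0#)
    ; S-kernel    = λ {v} e → kernel m (free⇒≢0 free) v e (zeroV? v)
    ; irreducible = λ {a} {b} {v} a≢0 e → twist-irreducible (k ℕ.+ k) residue′ free
        (a≢0 ∘ cong proj₁) (embed-conjugate a) (embed-conjugate b)
        (trans e (sym (cong₂ _⊕_ (embed-⊗ b _) (embed-⊗ a v))))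
    }
    where
    open ≡-Reasoning
    residue′ : Residue (2 ℕ.^ (k ℕ.+ k))
    residue′ = subst Residue (trans q≡ss (sym (ℕₚ.^-distribˡ-+-* 2 k k))) residue
    -- A nonzero fixed element has a⁷ = 1 = 1⁷, and seventh powers are injective on nonzero elements
    -- of F in this case.
    eighth-fixed : ∀ a → a ^ 8 ≡ a → Dec (a ≡ 0#) → a ≡ 0# ⊎ a ≡ 1#
    eighth-fixed a e (yes a≡0) = inj₁ a≡0
    eighth-fixed a e (no a≢0)  = inj₂ (seventh-injective a≢0 (0≢1 ∘ sym) (·-cancelʳ a≢0
      (trans (*-comm (a ^ 7) a) (trans e (trans (sym (*-identityˡ a)) (cong (_· a) (sym (1^ 7))))))))
    kernel : ∀ m → m ≢ 0V → ∀ v → m ⊗ (v L.^ 8) ≡ 0V → Dec (v ≡ 0V) → v ≡ 0V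
    kernel m m≢0 v e (yes v≡0) = v≡0
    kernel m m≢0 v e (no v≢0)  = contradiction e (U.·-nonzero m≢0 (U.^-nonzero 8 v≢0))

-- Choice of the semilinear map by k modulo 3, and the final assembly.

open import Data.Nat using (_*_; _^_; _∸_; _/_)

data Mod3 : ℕ → Set where
  0mod3 : ∀ j → Mod3 (j * 3)
  1mod3 : ∀ j → Mod3 (1 ℕ.+ j * 3)
  2mod3 : ∀ j → Mod3 (2 ℕ.+ j * 3)

mod3 : ∀ k → Mod3 k
mod3 zero = 0mod3 0
mod3 (suc k) with mod3 k
... | 0mod3 j = 1mod3 j
... | 1mod3 j = 2mod3 j
... | 2mod3 j = 0mod3 (suc j)

-- Used with t = 8^j: for k = 3 j + 1 this gives q = (2 t)² ≡ 4 modulo 7, and for k = 3 j + 2 the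
-- companion below gives q = (4 t)² ≡ 2.
residue-2s : ∀ {t} M → t ≡ 1 ℕ.+ M * 7 → Residue ((2 * t) * (2 * t))
residue-2s M refl = M * (8 ℕ.+ M * 28) , inj₂ (lemma M)
  where
  lemma : ∀ M → (2 * (1 ℕ.+ M * 7)) * (2 * (1 ℕ.+ M * 7)) ≡ 4 ℕ.+ (M * (8 ℕ.+ M * 28)) * 7
  lemma = solve-∀

residue-4s : ∀ {t} M → t ≡ 1 ℕ.+ M * 7 → Residue ((2 * (2 * t)) * (2 * (2 * t)))
residue-4s M refl = 2 ℕ.+ M * (32 ℕ.+ M * 112) , inj₁ (lemma M)
  where
  lemma : ∀ M → (2 * (2 * (1 ℕ.+ M * 7))) * (2 * (2 * (1 ℕ.+ M * 7))) ≡ 2 ℕ.+ (2 ℕ.+ M * (32 ℕ.+ M * 112)) * 7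
  lemma = solve-∀

twist : ∀ {n} (F : FiniteField (suc n)) k (0<k : 0 < k) (q≡ss : suc n ≡ 2 ^ k * 2 ^ k) → Families.Twist F k 0<k q≡ss
twist F k 0<k q≡ss with mod3 k
... | 0mod3 j = let M , eq = 8^j≡1+7M j in CyclicTwist.cyclicTwist F (j * 3) 0<k q≡ss M eq
... | 1mod3 j = let M , eq = 8^j≡1+7M j in
  CubicTwist.cubicTwist F (1 ℕ.+ j * 3) 0<k q≡ss (subst Residue (sym q≡ss) (residue-2s M eq))
... | 2mod3 j = let M , eq = 8^j≡1+7M j in
  CubicTwist.cubicTwist F (2 ℕ.+ j * 3) 0<k q≡ss (subst Residue (sym q≡ss) (residue-4s M eq))

complete-cap : ∀ {q} (F : FiniteField q) k → 0 < k → q ≡ 2 ^ k * 2 ^ k → ∀ m →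
  Σ (List (AffineSpace.Point F (4 ℕ.+ m * 2))) λ C →
    AffineSpace.IsComplete F (4 ℕ.+ m * 2) C × length C ≡ 2 * (2 ^ k) ^ (3 ℕ.+ m * 2)
complete-cap {zero}  F k 0<k q≡ss m = contradiction (FiniteField.0# F) ¬Fin0
complete-cap {suc n} F k 0<k q≡ss m = cap , isComplete , length-cap
  where
  open Caps F k 0<k q≡ss
  open Doubling (family (twist F k 0<k q≡ss) m)

theorem1p3 : (t : ℕ) → 2 ∣ t → (F : FiniteField (2 ^ t)) →
    (n : ℕ) → 4 ≤ n → 2 ∣ n →
    Σ (List (AffineSpace.Point F n)) λ C →
    AffineSpace.IsComplete F n C × (length C ≡ 2 * (2 ^ (t / 2)) ^ (n ∸ 1))
-- For t = 0 a field with one element would have 0 = 1.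
theorem1p3 _ (divides zero refl) F _ _ _ = contradiction (unique _ _) (FiniteField.0≢1 F)
  where
  unique : (i j : Fin 1) → i ≡ j
  unique zero zero = refl
-- With t = 2 k and n = 2 (m + 2) the dimension computes to 4 + 2 m, so G lives in dimension 3 + 2
-- m: the twist in F³ followed by m parabolas.
theorem1p3 _ (divides k@(suc _) refl) F _ _ (divides (suc (suc m)) refl) =
  let C , complete , size = complete-cap F k (s≤s z≤n) q≡ss m
  in C , complete , trans size (cong (λ e → 2 * (2 ^ e) ^ (3 ℕ.+ m * 2)) (sym (m*n/n≡m k 2)))
  where
  q≡ss : 2 ^ (k * 2) ≡ 2 ^ k * 2 ^ k
  q≡ss = trans (sym (ℕₚ.^-*-assoc 2 k 2)) (cong (2 ^ k *_) (ℕₚ.*-identityʳ (2 ^ k)))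
theorem1p3 _ (divides (suc _) refl) F _ () (divides zero refl)
theorem1p3 _ (divides (suc _) refl) F _ (s≤s (s≤s ())) (divides (suc zero) refl)
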